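{- Let $1\le k\le m$ and let $\nu$ be any permutation of $[k]$. Then: (1) $W_\nu^m(x)=x$ for all $x\in S_{k,m}$. (2) The orbit structure of $W_\nu$ on $S_{k,m}$ equals the orbit structure of cyclic rotation $A\mapsto\{v+1 \bmod m: v\in A\}$ (residues taken in $\{1,\dots,m\}$) acting on the $k$-element subsets of $[m]$ (equivalently, of rotation on 2-colored necklaces with $k$ white and $m-k$ black beads); in particular it does not depend on $\nu$. (3) For $1\le i\le k$, $1\le j\le m$ let $g_{i,j}(x)=1$ if $x_i=j$ and $0$ otherwise. Then each $d_{i,j}=g_{i,j}-g_{k+1-i,\,m+1-j}$ is $0$-mesic for $W_\nu$ on $S_{k,m}$. For $1\le j\le m$ let $f_j(x)=1$ if $j\in\{x_1,\dots,x_k\}$ and $0$ otherwise; then $f_j$ is homomesic for $W_\nu$ on $S_{k,m}$ with average $k/m$ along every orbit. Hence any real linear combination of the $d_{i,j}$ and $f_j$ is homomesic.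
   Context: $S_{k,m}$ is the set of integer $k$-tuples $x=(x_1,\dots,x_k)$ with $0<x_1<\dots<x_k<m+1$. Winching on index $i$: $W_i(x)=y$ with $y_j=x_j$ for $j\ne i$, $y_i=x_i+1$ if $x_i+1<x_{i+1}$, and $y_i=x_{i-1}+1$ otherwise, with conventions $x_0=0$, $x_{k+1}=m+1$. For a permutation $\nu$ of $[k]$, $W_\nu=W_{\nu(k)}\circ W_{\nu(k-1)}\circ\cdots\circ W_{\nu(1)}$. A function on a finite set with a permutation $\tau$ is homomesic if its average over every $\tau$-orbit is the same constant, and $0$-mesic if that constant is $0$. -}

module Defs where

open import Algebra.Bundles using (CommutativeMonoid)
import Algebra.Properties.CommutativeSemigroup as CommutativeSemigroupProperties
open import Data.Bool using (true; false; if_then_else_)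
open import Data.Fin as Fin using (Fin; zero; suc; toℕ; fromℕ; inject₁; opposite)
open import Data.Fin.Permutation using (Permutation′; _⟨$⟩ʳ_)
open import Data.Fin.Properties using (toℕ-injective; toℕ-fromℕ<; toℕ-fromℕ; toℕ-inject₁; toℕ<n; nonZeroIndex; any?; suc-injective; inject₁-injective)
open import Data.Fin.Relation.Unary.Top using (view; ‵fromℕ; ‵inject₁)
open import Data.Fin.Subset using (Subset; ∣_∣) renaming (_∈_ to _∈ˢ_)
open import Data.Fin.Subset.Properties using (_∈?_)
open import Data.Integer using (+_)
open import Data.List using (List; length; map; foldr; foldl; allFin)
open import Data.List.Membership.Propositional using (_∈_)
open import Data.List.Relation.Binary.Disjoint.Propositional using (Disjoint)
open import Data.List.Relation.Binary.Permutation.Propositional using (_↭_)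
open import Data.List.Relation.Unary.AllPairs using (AllPairs)
open import Data.List.Relation.Unary.Any using (Any; here; there)
open import Data.List.Relation.Unary.Unique.Propositional using (Unique)
open import Data.Nat as ℕ using (ℕ; zero; suc; _∸_; _<_; _<?_; NonZero; s≤s)
open import Data.Nat.DivMod using (_mod_; _%_; n%n≡0; m<n⇒m%n≡m)
open import Data.Nat.GeneralisedArithmetic using (iterate)
import Data.Nat.Properties as ℕ
open import Data.Product using (Σ-syntax; ∃-syntax; _×_; _,_)
open import Data.Rational as ℚ using (ℚ; 0ℚ; 1ℚ; ½)
import Data.Rational.Properties as ℚ
open import Data.Vec using (Vec; []; _∷_; _∷ʳ_; lookup; _[_]≔_; tabulate; count; init; last)
import Data.Vec.Membership.DecPropositional as DecMembership
open import Data.Vec.Properties using (lookup∘update; lookup∘update′; tabulate-cong; tabulate∘lookup; []=⇒lookup; lookup⇒[]=)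
open import Function using (_⇔_; module Equivalence)
open import Relation.Binary.Definitions using (DecidableEquality)
open import Relation.Binary.PropositionalEquality using (_≡_; _≢_; refl; sym; trans; cong; cong₂; subst; subst₂; module ≡-Reasoning)
open import Relation.Nullary using (Dec; yes; no; does; contradiction)
open import Relation.Nullary.Decidable using (_×-dec_; dec-true; dec-false)
open import Relation.Unary using (Decidable)

-- Reals are Cauchy sequences of rationals; their equality is _≃_, not _≡_.
Cauchy : (ℕ → ℚ) → Set
Cauchy s = ∀ ε → 0ℚ ℚ.< ε →
  ∃[ N ] (∀ m n → N ℕ.≤ m → N ℕ.≤ n → ℚ.∣ s m ℚ.- s n ∣ ℚ.< ε)

record ℝ : Set where
  constructor mkℝ
  field
    seq    : ℕ → ℚ
    cauchy : Cauchy seq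

open ℝ public

infix 4 _≃_

_≃_ : ℝ → ℝ → Set
x ≃ y = ∀ ε → 0ℚ ℚ.< ε →
  ∃[ N ] (∀ n → N ℕ.≤ n → ℚ.∣ seq x n ℚ.- seq y n ∣ ℚ.< ε)

private
  open CommutativeSemigroupProperties
    (CommutativeMonoid.commutativeSemigroup ℚ.+-0-commutativeMonoid) using (interchange)

  half-pos : ∀ {ε} → 0ℚ ℚ.< ε → 0ℚ ℚ.< ½ ℚ.* ε
  half-pos {ε} 0<ε = subst (ℚ._< ½ ℚ.* ε) (ℚ.*-zeroʳ ½) (ℚ.*-monoʳ-<-pos ½ 0<ε)

  halves : ∀ ε → ½ ℚ.* ε ℚ.+ ½ ℚ.* ε ≡ ε
  halves ε = trans (sym (ℚ.*-distribʳ-+ ε ½ ½)) (ℚ.*-identityˡ ε)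

  const-cauchy : ∀ q → Cauchy (λ _ → q)
  const-cauchy q ε 0<ε =
    0 , λ _ _ _ _ → subst (ℚ._< ε) (sym (cong ℚ.∣_∣ (ℚ.+-inverseʳ q))) 0<ε

  +-cauchy : ∀ {s t} → Cauchy s → Cauchy t → Cauchy (λ n → s n ℚ.+ t n)
  +-cauchy {s} {t} cs ct ε 0<ε
    with cs (½ ℚ.* ε) (half-pos 0<ε) | ct (½ ℚ.* ε) (half-pos 0<ε)
  ... | M , p | N , q = M ℕ.⊔ N , λ m n ≤m ≤n → begin-strict
    ℚ.∣ (s m ℚ.+ t m) ℚ.- (s n ℚ.+ t n) ∣
      ≡⟨ cong ℚ.∣_∣ (regroup (s m) (t m) (s n) (t n)) ⟩
    ℚ.∣ (s m ℚ.- s n) ℚ.+ (t m ℚ.- t n) ∣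
      ≤⟨ ℚ.∣p+q∣≤∣p∣+∣q∣ (s m ℚ.- s n) (t m ℚ.- t n) ⟩
    ℚ.∣ s m ℚ.- s n ∣ ℚ.+ ℚ.∣ t m ℚ.- t n ∣
      <⟨ ℚ.+-mono-< (p m n (ℕ.m⊔n≤o⇒m≤o M N ≤m) (ℕ.m⊔n≤o⇒m≤o M N ≤n))
                    (q m n (ℕ.m⊔n≤o⇒n≤o M N ≤m) (ℕ.m⊔n≤o⇒n≤o M N ≤n)) ⟩
    ½ ℚ.* ε ℚ.+ ½ ℚ.* ε
      ≡⟨ halves ε ⟩
    ε ∎
    where
    open ℚ.≤-Reasoning
    regroup : ∀ a b c d →
      (a ℚ.+ b) ℚ.- (c ℚ.+ d) ≡ (a ℚ.- c) ℚ.+ (b ℚ.- d)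
    regroup a b c d = trans
      (cong ((a ℚ.+ b) ℚ.+_) (ℚ.neg-distrib-+ c d))
      (interchange a b (ℚ.- c) (ℚ.- d))

  neg-cauchy : ∀ {s} → Cauchy s → Cauchy (λ n → ℚ.- s n)
  neg-cauchy {s} cs ε 0<ε with cs ε 0<ε
  ... | N , p = N , λ m n ≤m ≤n →
    subst (ℚ._< ε)
      (trans (sym (ℚ.∣-p∣≡∣p∣ (s m ℚ.- s n))) (cong ℚ.∣_∣ (ℚ.neg-distrib-+ (s m) (ℚ.- s n))))
      (p m n ≤m ≤n)

  bounded : ∀ {s} → Cauchy s →
    ∃[ B ] ∃[ N ] (0ℚ ℚ.< B × (∀ n → N ℕ.≤ n → ℚ.∣ s n ∣ ℚ.< B))
  bounded {s} cs with cs 1ℚ (ℚ.positive⁻¹ 1ℚ)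
  ... | N , p = 1ℚ ℚ.+ ℚ.∣ s N ∣ , N
              , ℚ.+-mono-<-≤ (ℚ.positive⁻¹ 1ℚ) (ℚ.0≤∣p∣ (s N))
              , λ n ≤n → begin-strict
    ℚ.∣ s n ∣                          ≡⟨ cong ℚ.∣_∣ (split (s n) (s N)) ⟩
    ℚ.∣ (s n ℚ.- s N) ℚ.+ s N ∣        ≤⟨ ℚ.∣p+q∣≤∣p∣+∣q∣ (s n ℚ.- s N) (s N) ⟩
    ℚ.∣ s n ℚ.- s N ∣ ℚ.+ ℚ.∣ s N ∣    <⟨ ℚ.+-monoˡ-< ℚ.∣ s N ∣ (p n N ≤n ℕ.≤-refl) ⟩
    1ℚ ℚ.+ ℚ.∣ s N ∣                   ∎
    where
    open ℚ.≤-Reasoning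
    split : ∀ a b → a ≡ (a ℚ.- b) ℚ.+ b
    split a b = sym (trans (ℚ.+-assoc a (ℚ.- b) b)
      (trans (cong (a ℚ.+_) (ℚ.+-inverseˡ b)) (ℚ.+-identityʳ a)))

  *-cauchy : ∀ {s t} → Cauchy s → Cauchy t → Cauchy (λ n → s n ℚ.* t n)
  *-cauchy {s} {t} cs ct ε 0<ε
    with bounded {s} cs | bounded {t} ct
  ... | B , K , 0<B , s<B | C , L , 0<C , t<C = combine (cs δ 0<δ) (ct δ 0<δ)
    where
    open ℚ.≤-Reasoning
    D : ℚ
    D = B ℚ.+ C
    instance
      posD : ℚ.Positive D
      posD = ℚ.positive (ℚ.+-mono-< 0<B 0<C)
      nzD : ℚ.NonZero D
      nzD = ℚ.pos⇒nonZero D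
      posD⁻¹ : ℚ.Positive (ℚ.1/ D)
      posD⁻¹ = ℚ.1/pos⇒pos D
    δ : ℚ
    δ = ε ℚ.* ℚ.1/ D
    0<δ : 0ℚ ℚ.< δ
    0<δ = subst (ℚ._< δ) (ℚ.*-zeroˡ (ℚ.1/ D)) (ℚ.*-monoˡ-<-pos (ℚ.1/ D) 0<ε)
    D*δ : D ℚ.* δ ≡ ε
    D*δ = begin-equality
      D ℚ.* (ε ℚ.* ℚ.1/ D)   ≡⟨ ℚ.*-comm D δ ⟩
      ε ℚ.* ℚ.1/ D ℚ.* D     ≡⟨ ℚ.*-assoc ε (ℚ.1/ D) D ⟩
      ε ℚ.* (ℚ.1/ D ℚ.* D)   ≡⟨ cong (ε ℚ.*_) (ℚ.*-inverseˡ D) ⟩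
      ε ℚ.* 1ℚ               ≡⟨ ℚ.*-identityʳ ε ⟩
      ε                      ∎
    distrib : ∀ a b c → a ℚ.* (b ℚ.- c) ≡ a ℚ.* b ℚ.- a ℚ.* c
    distrib a b c = trans (ℚ.*-distribˡ-+ a b (ℚ.- c))
      (cong (a ℚ.* b ℚ.+_) (sym (ℚ.neg-distribʳ-* a c)))
    telescope : ∀ p q r → (p ℚ.- r) ℚ.+ (r ℚ.- q) ≡ p ℚ.- q
    telescope p q r = trans (ℚ.+-assoc p (ℚ.- r) (r ℚ.- q))
      (cong (p ℚ.+_) (trans (sym (ℚ.+-assoc (ℚ.- r) r (ℚ.- q)))
        (trans (cong (ℚ._- q) (ℚ.+-inverseˡ r)) (ℚ.+-identityˡ (ℚ.- q)))))
    regroup : ∀ a b c d →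
      a ℚ.* b ℚ.- c ℚ.* d ≡ a ℚ.* (b ℚ.- d) ℚ.+ d ℚ.* (a ℚ.- c)
    regroup a b c d = sym (trans
      (cong₂ ℚ._+_ (distrib a b d)
        (trans (distrib d a c) (cong₂ ℚ._-_ (ℚ.*-comm d a) (ℚ.*-comm d c))))
      (telescope (a ℚ.* b) (c ℚ.* d) (a ℚ.* d)))
    bound : ∀ a b {E} → ℚ.∣ a ∣ ℚ.< E → ℚ.∣ b ∣ ℚ.< δ → ℚ.∣ a ℚ.* b ∣ ℚ.< E ℚ.* δ
    bound a b {E} a<E b<δ = begin-strict
      ℚ.∣ a ℚ.* b ∣         ≡⟨ ℚ.∣p*q∣≡∣p∣*∣q∣ a b ⟩
      ℚ.∣ a ∣ ℚ.* ℚ.∣ b ∣   ≤⟨ ℚ.*-monoˡ-≤-nonNeg ℚ.∣ a ∣ {{ℚ.∣-∣-nonNeg a}} (ℚ.<⇒≤ b<δ) ⟩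
      ℚ.∣ a ∣ ℚ.* δ         <⟨ ℚ.*-monoˡ-<-pos δ {{ℚ.positive 0<δ}} a<E ⟩
      E ℚ.* δ               ∎
    combine :
      ∃[ N ] (∀ m n → N ℕ.≤ m → N ℕ.≤ n → ℚ.∣ s m ℚ.- s n ∣ ℚ.< δ) →
      ∃[ N ] (∀ m n → N ℕ.≤ m → N ℕ.≤ n → ℚ.∣ t m ℚ.- t n ∣ ℚ.< δ) →
      ∃[ N ] (∀ m n → N ℕ.≤ m → N ℕ.≤ n → ℚ.∣ s m ℚ.* t m ℚ.- s n ℚ.* t n ∣ ℚ.< ε)
    combine (M , p) (N , q) = (K ℕ.⊔ L) ℕ.⊔ (M ℕ.⊔ N) , λ m n ≤m ≤n →
      let K≤m = ℕ.m⊔n≤o⇒m≤o K L (ℕ.m⊔n≤o⇒m≤o (K ℕ.⊔ L) (M ℕ.⊔ N) ≤m)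
          L≤n = ℕ.m⊔n≤o⇒n≤o K L (ℕ.m⊔n≤o⇒m≤o (K ℕ.⊔ L) (M ℕ.⊔ N) ≤n)
          MN≤m = ℕ.m⊔n≤o⇒n≤o (K ℕ.⊔ L) (M ℕ.⊔ N) ≤m
          MN≤n = ℕ.m⊔n≤o⇒n≤o (K ℕ.⊔ L) (M ℕ.⊔ N) ≤n
      in begin-strict
        ℚ.∣ s m ℚ.* t m ℚ.- s n ℚ.* t n ∣
          ≡⟨ cong ℚ.∣_∣ (regroup (s m) (t m) (s n) (t n)) ⟩
        ℚ.∣ s m ℚ.* (t m ℚ.- t n) ℚ.+ t n ℚ.* (s m ℚ.- s n) ∣
          ≤⟨ ℚ.∣p+q∣≤∣p∣+∣q∣ (s m ℚ.* (t m ℚ.- t n)) (t n ℚ.* (s m ℚ.- s n)) ⟩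
        ℚ.∣ s m ℚ.* (t m ℚ.- t n) ∣ ℚ.+ ℚ.∣ t n ℚ.* (s m ℚ.- s n) ∣
          <⟨ ℚ.+-mono-<
               (bound (s m) (t m ℚ.- t n) (s<B m K≤m)
                 (q m n (ℕ.m⊔n≤o⇒n≤o M N MN≤m) (ℕ.m⊔n≤o⇒n≤o M N MN≤n)))
               (bound (t n) (s m ℚ.- s n) (t<C n L≤n)
                 (p m n (ℕ.m⊔n≤o⇒m≤o M N MN≤m) (ℕ.m⊔n≤o⇒m≤o M N MN≤n))) ⟩
        B ℚ.* δ ℚ.+ C ℚ.* δ
          ≡⟨ ℚ.*-distribʳ-+ δ B C ⟨
        D ℚ.* δ
          ≡⟨ D*δ ⟩
        ε ∎

infixl 6 _+_ _-_
infixl 7 _*_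

fromℚ : ℚ → ℝ
fromℚ q = mkℝ (λ _ → q) (const-cauchy q)

0ℝ 1ℝ : ℝ
0ℝ = fromℚ 0ℚ
1ℝ = fromℚ 1ℚ

_+_ _-_ _*_ : ℝ → ℝ → ℝ
x + y = mkℝ (λ n → seq x n ℚ.+ seq y n) (+-cauchy {seq x} {seq y} (cauchy x) (cauchy y))
x - y = mkℝ (λ n → seq x n ℚ.- seq y n)
            (+-cauchy {seq x} {λ n → ℚ.- seq y n} (cauchy x) (neg-cauchy {seq y} (cauchy y)))
x * y = mkℝ (λ n → seq x n ℚ.* seq y n) (*-cauchy {seq x} {seq y} (cauchy x) (cauchy y))

∑ : {A : Set} → List A → (A → ℝ) → ℝ
∑ xs f = foldr (λ x s → f x + s) 0ℝ xs

[_]? : {P : Set} → Dec P → ℝ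
[ P? ]? = if does P? then 1ℝ else 0ℝ

average : {A : Set} (f : A → ℝ) (xs : List A) .{{_ : NonZero (length xs)}} → ℝ
average f xs = fromℚ (+ 1 ℚ./ length xs) * ∑ xs f

-- For a permutation τ of a finite set the forward iterates of a point already
-- exhaust its orbit, so an orbit is listed, without repetition, by them.
record Orbit {X : Set} (τ : X → X) : Set where
  field
    base     : X
    elements : List X
    unique   : Unique elements
    complete : ∀ y → y ∈ elements ⇔ (∃[ n ] iterate τ base n ≡ y)

  size : ℕ
  size = length elements

  size-nonZero : NonZero size
  size-nonZero = nonEmpty (Equivalence.from (complete base) (0 , refl))
    where
    nonEmpty : ∀ {y xs} → y ∈ xs → NonZero (length xs)
    nonEmpty (here _)  = _
    nonEmpty (there _) = _

open Orbit public using (elements; size; size-nonZero)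

-- A complete list of the orbits of τ, each occurring once.
record OrbitPartition {X : Set} (τ : X → X) : Set where
  field
    orbits   : List (Orbit τ)
    disjoint : AllPairs (λ O P → Disjoint (elements O) (elements P)) orbits
    covers   : ∀ x → Any (λ O → x ∈ elements O) orbits

  sizes : List ℕ
  sizes = map size orbits

-- Equality of the multisets of orbit sizes; the partition of a set into orbits
-- being unique, the choice of P and Q is immaterial.
SameOrbitStructure : {X Y : Set} → (X → X) → (Y → Y) → Set
SameOrbitStructure τ σ =
  Σ[ P ∈ OrbitPartition τ ] Σ[ Q ∈ OrbitPartition σ ]
    OrbitPartition.sizes P ↭ OrbitPartition.sizes Q

_-mesicFor_ : {X : Set} → ℝ → (X → X) → (X → ℝ) → Set
(c -mesicFor τ) f = ∀ (O : Orbit τ) → average f (elements O) {{size-nonZero O}} ≃ c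

HomomesicFor : {X : Set} → (X → X) → (X → ℝ) → Set
HomomesicFor τ f = ∃[ c ] (c -mesicFor τ) f

-- (x₀, x₁, …, x_k, x_{k+1}) with x₀ = 0 and x_{k+1} = m + 1.  Indices in Fin
-- start at 0: for i : Fin k, lookup x i is x_{toℕ i + 1}, which sits at position
-- suc (inject₁ i) of the padded tuple.
pad : ∀ {k} → ℕ → Vec ℕ k → Vec ℕ (2 ℕ.+ k)
pad m x = 0 ∷ (x ∷ʳ suc m)

Increasing : ∀ {n} → Vec ℕ (suc n) → Set
Increasing {n} p = ∀ (a : Fin n) → lookup p (inject₁ a) < lookup p (suc a)

record S (k m : ℕ) : Set where
  constructor mkS
  field
    tuple       : Vec ℕ k
    .increasing : Increasing (pad m tuple)

open S public using (tuple)

winchValue : ∀ {k} → ℕ → Fin k → Vec ℕ k → ℕ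
winchValue m i x with suc (lookup x i) <? lookup (pad m x) (suc (suc i))
... | yes _ = suc (lookup x i)
... | no  _ = suc (lookup (pad m x) (inject₁ (inject₁ i)))

winchTuple : ∀ {k} → ℕ → Fin k → Vec ℕ k → Vec ℕ k
winchTuple m i x = x [ i ]≔ winchValue m i x

lookup-pad : ∀ {k} m (x : Vec ℕ k) i → lookup (pad m x) (suc (inject₁ i)) ≡ lookup x i
lookup-pad m (_ ∷ x) zero    = refl
lookup-pad m (_ ∷ x) (suc i) = lookup-pad m x i

update-∷ʳ : ∀ {k} (x : Vec ℕ k) i v w → (x [ i ]≔ v) ∷ʳ w ≡ (x ∷ʳ w) [ inject₁ i ]≔ v
update-∷ʳ (_ ∷ x) zero    v w = refl
update-∷ʳ (a ∷ x) (suc i) v w = cong (a ∷_) (update-∷ʳ x i v w)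

inject₁≢suc : ∀ {n} (a : Fin n) → inject₁ a ≢ suc a
inject₁≢suc (suc a) eq = inject₁≢suc a (suc-injective eq)

update-increasing : ∀ {n} (p : Vec ℕ (2 ℕ.+ n)) (i : Fin n) v → Increasing p →
  lookup p (inject₁ (inject₁ i)) < v → v < lookup p (suc (suc i)) →
  Increasing (p [ suc (inject₁ i) ]≔ v)
update-increasing p i v inc lo hi a
  with inject₁ a Fin.≟ suc (inject₁ i) | suc a Fin.≟ suc (inject₁ i)
... | yes eq | _ with inject₁-injective {i = a} {j = suc i} eq
...   | refl = subst₂ _<_
        (sym (lookup∘update (suc (inject₁ i)) p v))
        (sym (lookup∘update′ (λ e → inject₁≢suc (suc i) (sym e)) p v))
        hi
update-increasing p i v inc lo hi a | no _ | yes eq with suc-injective eq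
...   | refl = subst₂ _<_
        (sym (lookup∘update′ (inject₁≢suc (inject₁ i)) p v))
        (sym (lookup∘update (suc (inject₁ i)) p v))
        lo
update-increasing p i v inc lo hi a | no ≢₁ | no ≢₂ = subst₂ _<_
        (sym (lookup∘update′ ≢₁ p v))
        (sym (lookup∘update′ ≢₂ p v))
        (inc a)

winch-increasing : ∀ {k} m (i : Fin k) (x : Vec ℕ k) →
  Increasing (pad m x) → Increasing (pad m (winchTuple m i x))
winch-increasing m i x inc =
  subst Increasing (cong (0 ∷_) (sym (update-∷ʳ x i (winchValue m i x) (suc m))))
    (update-increasing (pad m x) i (winchValue m i x) inc lo hi)
  where
  below : lookup (pad m x) (inject₁ (inject₁ i)) < lookup x i
  below = subst (lookup (pad m x) (inject₁ (inject₁ i)) <_) (lookup-pad m x i) (inc (inject₁ i))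
  above : lookup x i < lookup (pad m x) (suc (suc i))
  above = subst (_< lookup (pad m x) (suc (suc i))) (lookup-pad m x i) (inc (suc i))
  lo : lookup (pad m x) (inject₁ (inject₁ i)) < winchValue m i x
  lo with suc (lookup x i) <? lookup (pad m x) (suc (suc i))
  ... | yes _ = ℕ.m<n⇒m<1+n below
  ... | no  _ = ℕ.≤-refl
  hi : winchValue m i x < lookup (pad m x) (suc (suc i))
  hi with suc (lookup x i) <? lookup (pad m x) (suc (suc i))
  ... | yes p = p
  ... | no  _ = ℕ.≤-<-trans below above

winch : ∀ {k m} → Fin k → S k m → S k m
winch {m = m} i (mkS x inc) = mkS (winchTuple m i x) (winch-increasing m i x inc)

-- W_{ν(k)} ∘ ⋯ ∘ W_{ν(1)}: the winch at ν(1) is applied first.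
W : ∀ {k m} → Permutation′ k → S k m → S k m
W {k} ν x = foldl (λ y i → winch (ν ⟨$⟩ʳ i) y) x (allFin k)

rotateVec : ∀ {A : Set} {n} → Vec A n → Vec A n
rotateVec {n = zero}  xs = xs
rotateVec {n = suc n} xs = last xs ∷ init xs

count-∷ : ∀ {A : Set} {P : A → Set} (P? : Decidable P) {n} y z (ys : Vec A n) →
  count P? (y ∷ z ∷ ys) ≡ count P? (z ∷ y ∷ ys)
count-∷ P? y z ys with does (P? y) | does (P? z)
... | true  | true  = refl
... | true  | false = refl
... | false | true  = refl
... | false | false = refl

count-cong-∷ : ∀ {A : Set} {P : A → Set} (P? : Decidable P) {n} y {ys zs : Vec A n} →
  count P? ys ≡ count P? zs → count P? (y ∷ ys) ≡ count P? (y ∷ zs)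
count-cong-∷ P? y eq with does (P? y)
... | true  = cong suc eq
... | false = eq

count-rotate : ∀ {A : Set} {P : A → Set} (P? : Decidable P) {n} (xs : Vec A n) →
  count P? (rotateVec xs) ≡ count P? xs
count-rotate P? {zero}        xs           = refl
count-rotate P? {suc zero}    (x ∷ [])     = refl
count-rotate P? {suc (suc n)} (x ∷ xs)     =
  trans (count-∷ P? (last xs) x (init xs))
        (count-cong-∷ P? x {last xs ∷ init xs} {xs} (count-rotate P? xs))

-- v ↦ v + 1 modulo m.  The element v of {1, …, m} is represented by v - 1 in Fin m.
next : ∀ {m} → Fin m → Fin m
next {m} v = _mod_ (suc (toℕ v)) m {{nonZeroIndex v}}

hit? : ∀ {m n} (f : Fin m → Fin n) (A : Subset m) (w : Fin n) →
  Dec (∃[ v ] (v ∈ˢ A × f v ≡ w))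
hit? f A w = any? λ v → (v ∈? A) ×-dec (f v Fin.≟ w)

image : ∀ {m n} → (Fin m → Fin n) → Subset m → Subset n
image f A = tabulate λ w → does (hit? f A w)

next-fromℕ : ∀ n → next (fromℕ n) ≡ zero
next-fromℕ n = toℕ-injective (begin
  toℕ (next (fromℕ n))         ≡⟨ toℕ-fromℕ< _ ⟩
  suc (toℕ (fromℕ n)) % suc n  ≡⟨ cong (λ a → suc a % suc n) (toℕ-fromℕ n) ⟩
  suc n % suc n                ≡⟨ n%n≡0 (suc n) ⟩
  0                            ∎)
  where open ≡-Reasoning

next-inject₁ : ∀ {n} (u : Fin n) → next (inject₁ u) ≡ suc u
next-inject₁ {n} u = toℕ-injective (begin
  toℕ (next (inject₁ u))         ≡⟨ toℕ-fromℕ< _ ⟩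
  suc (toℕ (inject₁ u)) % suc n  ≡⟨ cong (λ a → suc a % suc n) (toℕ-inject₁ u) ⟩
  suc (toℕ u) % suc n            ≡⟨ m<n⇒m%n≡m (s≤s (toℕ<n u)) ⟩
  suc (toℕ u)                    ∎)
  where open ≡-Reasoning

next-surjective : ∀ {n} (w : Fin n) → ∃[ v ] next v ≡ w
next-surjective {suc n} zero    = fromℕ n , next-fromℕ n
next-surjective {suc n} (suc w) = inject₁ w , next-inject₁ w

lookup-last : ∀ {A : Set} {n} (xs : Vec A (suc n)) → last xs ≡ lookup xs (fromℕ n)
lookup-last {n = zero}  (x ∷ [])     = refl
lookup-last {n = suc n} (x ∷ xs) = lookup-last xs

lookup-init : ∀ {A : Set} {n} (xs : Vec A (suc n)) u → lookup (init xs) u ≡ lookup xs (inject₁ u)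
lookup-init {n = suc n} (x ∷ xs) zero    = refl
lookup-init {n = suc n} (x ∷ xs) (suc u) = lookup-init xs u

lookup-rotate : ∀ {A : Set} {n} (xs : Vec A n) v → lookup (rotateVec xs) (next v) ≡ lookup xs v
lookup-rotate {n = suc n} xs v with view v
... | ‵fromℕ     rewrite next-fromℕ n = lookup-last xs
... | ‵inject₁ u rewrite next-inject₁ u = lookup-init xs u

image-next : ∀ {m} (A : Subset m) → image next A ≡ rotateVec A
image-next A = trans (tabulate-cong pointwise) (tabulate∘lookup (rotateVec A))
  where
  pointwise : ∀ w → does (hit? next A w) ≡ lookup (rotateVec A) w
  pointwise w with lookup (rotateVec A) w in eq
  ... | true  = dec-true (hit? next A w)
    (let v , nv≡w = next-surjective w in
     v , lookup⇒[]= v A (trans (sym (lookup-rotate A v)) (trans (cong (lookup (rotateVec A)) nv≡w) eq)) , nv≡w)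
  ... | false = dec-false (hit? next A w) λ where
    (v , v∈A , refl) → contradiction
      (trans (sym ([]=⇒lookup v∈A)) (trans (sym (lookup-rotate A v)) eq)) λ ()

record KSubset (k m : ℕ) : Set where
  constructor mkKSubset
  field
    set   : Subset m
    .card : ∣ set ∣ ≡ k

rotateSubset : ∀ {k m} → KSubset k m → KSubset k m
rotateSubset (mkKSubset A card) =
  mkKSubset (image next A)
    (trans (cong ∣_∣ (image-next A)) (trans (count-rotate _ A) card))

data Colour : Set where
  white black : Colour

_≟ᶜ_ : DecidableEquality Colour
white ≟ᶜ white = yes refl
white ≟ᶜ black = no λ ()
black ≟ᶜ white = no λ ()
black ≟ᶜ black = yes refl

record Necklace (k m : ℕ) : Set where
  constructor mkNecklace
  field
    beads   : Vec Colour m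
    .whites : count (_≟ᶜ white) beads ≡ k
    .blacks : count (_≟ᶜ black) beads ≡ m ∸ k

rotateNecklace : ∀ {k m} → Necklace k m → Necklace k m
rotateNecklace (mkNecklace c w b) =
  mkNecklace (rotateVec c)
    (trans (count-rotate (_≟ᶜ white) c) w)
    (trans (count-rotate (_≟ᶜ black) c) b)

-- i and j stand for the indices toℕ i + 1 and toℕ j + 1, so
-- opposite i and opposite j stand for k + 1 - i and m + 1 - j.
g : ∀ {k m} → Fin k → Fin m → S k m → ℝ
g i j x = [ lookup (tuple x) i ℕ.≟ suc (toℕ j) ]?

d : ∀ {k m} → Fin k → Fin m → S k m → ℝ
d i j x = g i j x - g (opposite i) (opposite j) x

f : ∀ {k m} → Fin m → S k m → ℝ
f j x = [ suc (toℕ j) ∈ᵛ? tuple x ]?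
  where open DecMembership ℕ._≟_ renaming (_∈?_ to _∈ᵛ?_)

linearCombination : ∀ {k m} → (Fin k → Fin m → ℝ) → (Fin m → ℝ) → S k m → ℝ
linearCombination {k} {m} a b x =
  ∑ (allFin k) (λ i → ∑ (allFin m) λ j → a i j * d i j x) +
  ∑ (allFin m) (λ j → b j * f j x)

{-# OPTIONS --safe #-}

-- A k-subset of ℤ/m, written as a cyclic 0-1 word w, is turned into a tuple by letting x_i be
-- the position of the i-th true letter of a rotation of w; the number of rotations used for
-- column i counts the c < i for which ν winches column c before column c + 1.  With these
-- offsets, at the moment column i is winched its right neighbour is read from a word rotated
-- once more and its left neighbour from the same word, so the winch moves column i on to
-- the next rotation.  Hence W_ν is conjugate to rotation of k-subsets, which gives the
-- period m and the orbit structure.  Column 1 of the successive iterates reveals all letters of w,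
-- so the conjugating map is injective, and a pigeonhole argument makes it bijective.
--
-- A sum over an orbit becomes a rotation-invariant sum over words.  With c_j(w) the number
-- of true letters among the first j, [pos_i = j] = [i ≤ c_j] - [i ≤ c_{j-1}], and the first
-- m - j and last j letters contain k true letters together; this yields the symmetry behind
-- d_{i,j}.  Summing over i, f_j contributes c_j - c_{j-1}, whose total is independent of j.

module Submission where

open import Defs renaming (_+_ to _+ᴿ_; _*_ to _*ᴿ_) hiding (_-_)
open import Algebra.Bundles using (CommutativeRing)
import Algebra.Properties.CommutativeSemigroup as CommutativeSemigroup
import Algebra.Properties.Semiring.Mult as Mult
open import Data.Bool using (Bool; true; false; if_then_else_)
import Data.Bool.Properties as Bool
open import Data.Fin using (Fin; zero; suc; toℕ; fromℕ; fromℕ<; inject₁; opposite)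
open import Data.Fin.Permutation using (Permutation′; _⟨$⟩ʳ_; _⟨$⟩ˡ_; inverseˡ; inverseʳ)
import Data.Fin.Properties as Fin
open import Data.Fin.Properties using (toℕ<n; toℕ-injective; toℕ-fromℕ; toℕ-fromℕ<; toℕ-inject₁; fromℕ<-toℕ; opposite-prop; pigeonhole)
open import Data.Fin.Relation.Unary.Top using (view; ‵fromℕ; ‵inject₁)
open import Data.Fin.Subset using (∣_∣)
import Data.Integer as ℤ
import Data.Integer.Properties as ℤ
open import Data.List as List using (List; []; _∷_; _++_; map; length; foldl; foldr; allFin; applyUpTo; deduplicate)
open import Data.List.Membership.Propositional using (_∈_)
open import Data.List.Membership.Propositional.Properties using (∈-map⁺; ∈-map⁻; ∈-++⁺ˡ; ∈-++⁺ʳ; ∈-applyUpTo⁺; ∈-applyUpTo⁻; ∈-deduplicate⁺; ∈-deduplicate⁻)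
open import Data.List.Membership.Propositional.Properties.WithK using (unique∧set⇒bag)
open import Data.List.Properties using (length-map; map-∘; map-cong)
open import Data.List.Relation.Binary.BagAndSetEquality using (∼bag⇒↭)
open import Data.List.Relation.Binary.Disjoint.Propositional using (Disjoint)
open import Data.List.Relation.Binary.Permutation.Propositional using (_↭_; ↭-reflexive; ↭-trans)
open import Data.List.Relation.Binary.Permutation.Propositional.Properties using (map⁺)
open import Data.List.Relation.Unary.All as All using (All; []; _∷_)
import Data.List.Relation.Unary.All.Properties as All
open import Data.List.Relation.Unary.AllPairs as AllPairs using (AllPairs; []; _∷_)
import Data.List.Relation.Unary.AllPairs.Properties as AllPairs
open import Data.List.Relation.Unary.Any as Any using (Any; here; there; any?; index)
import Data.List.Relation.Unary.Any.Properties as Any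
import Data.List.Relation.Unary.Unique.DecPropositional.Properties as DecUnique
import Data.List.Relation.Unary.Unique.Propositional.Properties as Unique
open import Data.Nat hiding (_/_)
import Data.Nat.DivMod as ℕ
open import Data.Nat.DivMod using (_%_; m≡m%n+[m/n]*n; m%n<n)
open import Data.Nat.GeneralisedArithmetic using (iterate)
open import Data.Nat.ListAction using (sum)
open import Data.Nat.ListAction.Properties using (sum-↭)
open import Data.Nat.Properties
open import Data.Product using (_×_; _,_; ∃-syntax; proj₁; proj₂)
open import Data.Rational using (_/_)
open import Data.Rational as ℚ using (ℚ; 0ℚ; 1ℚ; toℚᵘ)
import Data.Rational.Properties as ℚ
open import Data.Rational.Unnormalised using (mkℚᵘ; *≡*) renaming (_≃_ to _≃ᵘ_)
import Data.Rational.Unnormalised as ℚᵘ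
import Data.Rational.Unnormalised.Properties as ℚᵘ
open import Data.Sum using (_⊎_; inj₁; inj₂)
open import Data.Vec as Vec using (Vec; []; _∷_; _∷ʳ_; lookup; tabulate; initLast; count)
import Data.Vec.Membership.DecPropositional as DecMembership
import Data.Vec.Properties as Vec
open import Function using (_∘_; id; mk⇔; module Equivalence)
open import Function.Definitions using (Injective)
open import Relation.Binary.Definitions using (DecidableEquality; tri<; tri≈; tri>)
open import Relation.Binary.PropositionalEquality
open import Relation.Nullary using (¬_; Dec; yes; no; does; contradiction)
open import Relation.Nullary.Decidable using (recompute; dec-true; dec-false; map′)

open CommutativeSemigroup +-commutativeSemigroup using (interchange)
open CommutativeSemigroup (CommutativeRing.+-commutativeSemigroup ℚ.+-*-commutativeRing) using () renaming (interchange to ℚ-interchange)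
open CommutativeSemigroup (CommutativeRing.*-commutativeSemigroup ℚ.+-*-commutativeRing) using (x∙yz≈y∙xz; x∙yz≈z∙xy)
open Mult (CommutativeRing.semiring ℚ.+-*-commutativeRing) using (×-homo-+; ×1-homo-*) renaming (_×_ to _·_)
open DecMembership _≟_ using () renaming (_∈?_ to _∈ᵛ?_)
open KSubset using (set)

private variable
  k m n : ℕ
  X Y Z : Set

-- Cyclic words

𝟙 : Bool → ℕ
𝟙 b = if b then 1 else 0

iterate-suc : ∀ (φ : X → X) x n → iterate φ x (suc n) ≡ φ (iterate φ x n)
iterate-suc φ x zero    = refl
iterate-suc φ x (suc n) = iterate-suc φ (φ x) n

iterate-+ : ∀ (φ : X → X) x a b → iterate φ x (a + b) ≡ iterate φ (iterate φ x a) b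
iterate-+ φ x zero    b = refl
iterate-+ φ x (suc a) b = iterate-+ φ (φ x) a b

-- The 1-based position of the i-th true letter, with the junk values 0 for i = 0
-- and m + 1 for i beyond the number of true letters: the conventions for x₀ and x_{k+1}.
pos : ℕ → Vec Bool m → ℕ
pos zero    w           = 0
pos (suc i) []          = 1
pos (suc i) (true  ∷ w) = suc (pos i w)
pos (suc i) (false ∷ w) = suc (pos (suc i) w)

pos-suc : ∀ i (w : Vec Bool m) → ∃[ p ] pos (suc i) w ≡ suc p
pos-suc i []          = _ , refl
pos-suc i (true  ∷ w) = _ , refl
pos-suc i (false ∷ w) = _ , refl

0<pos-suc : ∀ i (w : Vec Bool m) → 0 < pos (suc i) w
0<pos-suc i w with p , eq ← pos-suc i w = subst (0 <_) (sym eq) z<s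

-- The bound admits `i = ∣ w ∣` because the junk value `m + 1` lies to the right of every letter.
pos-< : ∀ {i} (w : Vec Bool m) → i ≤ ∣ w ∣ → pos i w < pos (suc i) w
pos-< {i = zero}  w           _         = 0<pos-suc 0 w
pos-< {i = suc i} (true  ∷ w) (s≤s i≤w) = s<s (pos-< w i≤w)
pos-< {i = suc i} (false ∷ w) i≤w       = s<s (pos-< w i≤w)

pos-end : (w : Vec Bool m) → pos (suc ∣ w ∣) w ≡ suc m
pos-end []          = refl
pos-end (true  ∷ w) = cong suc (pos-end w)
pos-end (false ∷ w) = cong suc (pos-end w)

-- If `b` is true, its position `m + 1` is the very junk value that `pos` gave to that index in `u`.
-- Past the last true letter the junk values of the two words differ, whence the bound.
pos-∷ʳ : ∀ {i} (u : Vec Bool m) b → i ≤ ∣ u ∷ʳ b ∣ → pos i (u ∷ʳ b) ≡ pos i u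
pos-∷ʳ {i = zero}        u           b     _         = refl
pos-∷ʳ {i = suc zero}    []          true  _         = refl
pos-∷ʳ {i = suc (suc _)} []          true  (s≤s ())
pos-∷ʳ {i = suc i}       (true  ∷ u) b     (s≤s i≤)  = cong suc (pos-∷ʳ u b i≤)
pos-∷ʳ {i = suc i}       (false ∷ u) b     i≤        = cong suc (pos-∷ʳ u b i≤)

∣∷ʳfalse∣ : (u : Vec Bool m) → ∣ u ∷ʳ false ∣ ≡ ∣ u ∣
∣∷ʳfalse∣ []          = refl
∣∷ʳfalse∣ (true  ∷ u) = cong suc (∣∷ʳfalse∣ u)
∣∷ʳfalse∣ (false ∷ u) = ∣∷ʳfalse∣ u

-- The two cases of winching, according to the last letter of w.
pos-rotate : ∀ {i} (w : Vec Bool m) → i < ∣ w ∣ →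
  let x = pos (suc i) w ; y = pos (suc i) (rotateVec w) ; z = pos (2 + i) (rotateVec w) in
  (suc x < z × y ≡ suc x) ⊎ (z ≡ suc x × y ≡ suc (pos i w))
pos-rotate {zero}  []  ()
pos-rotate {suc m} w i<w with initLast w
... | u , true , refl =
  inj₂ (cong suc (sym (pos-∷ʳ u true i<w)) , cong suc (sym (pos-∷ʳ u true (<⇒≤ i<w))))
... | u , false , refl rewrite pos-∷ʳ u false i<w =
  inj₁ (s<s (pos-< u (subst (_ ≤_) (∣∷ʳfalse∣ u) i<w)) , refl)

-- Both cases of `pos-rotate` give it; it keeps neighbouring columns in order when the right one is
-- read a rotation ahead.
pos-<-rotate : ∀ {i} (w : Vec Bool m) → i ≤ ∣ w ∣ → pos i w < pos (suc i) (rotateVec w)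
pos-<-rotate {i = zero}  w i≤w = 0<pos-suc 0 (rotateVec w)
pos-<-rotate {i = suc i} w i<w with pos-rotate w i<w
... | inj₁ (x<z , _) = <-trans (n<1+n _) x<z
... | inj₂ (z≡x , _) = subst (pos (suc i) w <_) (sym z≡x) (n<1+n _)

ρ : Vec Bool m → ℕ → Vec Bool m
ρ = iterate rotateVec

∣rotate∣ : (w : Vec Bool m) → ∣ rotateVec w ∣ ≡ ∣ w ∣
∣rotate∣ w = count-rotate _ w

∣ρ∣ : ∀ (w : Vec Bool m) n → ∣ ρ w n ∣ ≡ ∣ w ∣
∣ρ∣ w zero    = refl
∣ρ∣ w (suc n) = trans (∣ρ∣ (rotateVec w) n) (∣rotate∣ w)

-- Single letters under rotation, and the period of rotation

at : Vec Bool m → ℕ → Bool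
at []      j       = false
at (b ∷ w) zero    = b
at (b ∷ w) (suc j) = at w j

at-extensional : (v w : Vec Bool m) → (∀ j → j < m → at v j ≡ at w j) → v ≡ w
at-extensional []      []      _  = refl
at-extensional (a ∷ v) (b ∷ w) eq =
  cong₂ _∷_ (eq 0 z<s) (at-extensional v w λ j j<m → eq (suc j) (s<s j<m))

at-∷ʳ : ∀ {j} (u : Vec Bool n) b → j < n → at (u ∷ʳ b) j ≡ at u j
at-∷ʳ {j = zero}  (a ∷ u) b _         = refl
at-∷ʳ {j = suc j} (a ∷ u) b (s<s j<n) = at-∷ʳ u b j<n

at-∷ʳ-last : ∀ (u : Vec Bool n) b → at (u ∷ʳ b) n ≡ b
at-∷ʳ-last []      b = refl
at-∷ʳ-last (a ∷ u) b = at-∷ʳ-last u b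

at-rotate-suc : ∀ {j} (w : Vec Bool m) → suc j < m → at (rotateVec w) (suc j) ≡ at w j
at-rotate-suc {m = suc m} w (s<s j<m) with initLast w
... | u , b , refl = sym (at-∷ʳ u b j<m)

at-rotate-zero : (w : Vec Bool (suc n)) → at (rotateVec w) 0 ≡ at w n
at-rotate-zero w with initLast w
... | u , b , refl = sym (at-∷ʳ-last u b)

at-ρ : ∀ j n (w : Vec Bool m) → j + n < m → at (ρ w n) (j + n) ≡ at w j
at-ρ j zero    w lt = cong (at w) (+-identityʳ j)
at-ρ j (suc n) w lt rewrite +-suc j n =
  trans (at-ρ (suc j) n (rotateVec w) lt) (at-rotate-suc w (≤-<-trans (s≤s (m≤m+n j n)) lt))

-- All but one of these rotations carry letter `j` to the last place, and the remaining one wraps it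
-- round to the front.
at-zero-ρ : ∀ {j} (w : Vec Bool m) → j < m → at (ρ w (m ∸ j)) 0 ≡ at w j
at-zero-ρ {suc m} {j} w (s≤s j≤m) = begin
  at (ρ w (suc m ∸ j)) 0             ≡⟨ cong (λ n → at (ρ w n) 0) (+-∸-assoc 1 j≤m) ⟩
  at (ρ w (suc (m ∸ j))) 0           ≡⟨ cong (λ v → at v 0) (iterate-suc rotateVec w (m ∸ j)) ⟩
  at (rotateVec (ρ w (m ∸ j))) 0     ≡⟨ at-rotate-zero (ρ w (m ∸ j)) ⟩
  at (ρ w (m ∸ j)) m                 ≡⟨ cong (at (ρ w (m ∸ j))) (m+[n∸m]≡n j≤m) ⟨
  at (ρ w (m ∸ j)) (j + (m ∸ j))     ≡⟨ at-ρ j (m ∸ j) w (s≤s (≤-reflexive (m+[n∸m]≡n j≤m))) ⟩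
  at w j                             ∎
  where open ≡-Reasoning

-- The first `m ∸ j` rotations bring letter `j` to the front, and `j` more bring it back to its
-- place.
ρ-period : (w : Vec Bool m) → ρ w m ≡ w
ρ-period {m} w = at-extensional (ρ w m) w λ j j<m → begin
  at (ρ w m) j                     ≡⟨ cong (λ n → at (ρ w n) j) (m∸n+n≡m (<⇒≤ j<m)) ⟨
  at (ρ w (m ∸ j + j)) j           ≡⟨ cong (λ v → at v j) (iterate-+ rotateVec w (m ∸ j) j) ⟩
  at (ρ (ρ w (m ∸ j)) j) j         ≡⟨ at-ρ 0 j (ρ w (m ∸ j)) j<m ⟩
  at (ρ w (m ∸ j)) 0               ≡⟨ at-zero-ρ w j<m ⟩
  at w j                           ∎
  where open ≡-Reasoning

-- Prefix counts, the c_j of the opening comment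

prefix : ℕ → Vec Bool m → ℕ
prefix zero    w       = 0
prefix (suc j) []      = 0
prefix (suc j) (b ∷ w) = 𝟙 b + prefix j w

prefix-full : (w : Vec Bool m) → prefix m w ≡ ∣ w ∣
prefix-full []          = refl
prefix-full (true  ∷ w) = cong suc (prefix-full w)
prefix-full (false ∷ w) = prefix-full w

prefix-≤ : ∀ j (w : Vec Bool m) → prefix j w ≤ ∣ w ∣
prefix-≤ zero    w           = z≤n
prefix-≤ (suc j) []          = z≤n
prefix-≤ (suc j) (true  ∷ w) = s≤s (prefix-≤ j w)
prefix-≤ (suc j) (false ∷ w) = prefix-≤ j w

prefix-suc : ∀ j (w : Vec Bool m) → prefix (suc j) w ≡ prefix j w + 𝟙 (at w j)
prefix-suc zero    []      = refl
prefix-suc (suc j) []      = refl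
prefix-suc zero    (b ∷ w) = +-identityʳ (𝟙 b)
prefix-suc (suc j) (b ∷ w) = trans (cong (𝟙 b +_) (prefix-suc j w)) (sym (+-assoc (𝟙 b) _ _))

prefix-∷ʳ : ∀ {j} (u : Vec Bool n) b → j ≤ n → prefix j (u ∷ʳ b) ≡ prefix j u
prefix-∷ʳ {j = zero}  u       b _         = refl
prefix-∷ʳ {j = suc j} (a ∷ u) b (s≤s j≤n) = cong (𝟙 a +_) (prefix-∷ʳ u b j≤n)

prefix-rotate : ∀ {j} (w : Vec Bool (suc n)) → j ≤ n →
  prefix (suc j) (rotateVec w) ≡ 𝟙 (at w n) + prefix j w
prefix-rotate w j≤n with initLast w
... | u , b , refl rewrite prefix-∷ʳ u b j≤n | at-∷ʳ-last u b = refl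

-- The last j letters of w are the first j letters of its j-th rotation.
prefix-split : ∀ i j (w : Vec Bool m) → i + j ≡ m → prefix i w + prefix j (ρ w j) ≡ ∣ w ∣
prefix-split i zero w refl rewrite +-identityʳ i = trans (+-identityʳ _) (prefix-full w)
prefix-split {zero} zero    (suc j) w ()
prefix-split {zero} (suc i) (suc j) w ()
-- The last letter of `w` is taken out of the second count and, after a rotation, becomes the first
-- letter of the longer prefix `suc i`.
prefix-split {suc m} i (suc j) w eq = begin
  prefix i w + prefix (suc j) (ρ w (suc j))
    ≡⟨ cong (prefix i w +_) (prefix-suc j (ρ w (suc j))) ⟩
  prefix i w + (prefix j (ρ w (suc j)) + 𝟙 (at (ρ w (suc j)) j))
    ≡⟨ cong (λ b → prefix i w + (prefix j (ρ w (suc j)) + 𝟙 b)) letter ⟩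
  prefix i w + (prefix j (ρ w (suc j)) + 𝟙 (at w m))
    ≡⟨ +-comm (prefix i w) _ ⟩
  prefix j (ρ w (suc j)) + 𝟙 (at w m) + prefix i w
    ≡⟨ +-assoc (prefix j (ρ w (suc j))) _ _ ⟩
  prefix j (ρ w (suc j)) + (𝟙 (at w m) + prefix i w)
    ≡⟨ cong (prefix j (ρ w (suc j)) +_) (prefix-rotate w (m+n≤o⇒m≤o i (≤-reflexive i+j≡m))) ⟨
  prefix j (ρ w (suc j)) + prefix (suc i) (rotateVec w)
    ≡⟨ +-comm (prefix j (ρ w (suc j))) _ ⟩
  prefix (suc i) (rotateVec w) + prefix j (ρ (rotateVec w) j)
    ≡⟨ prefix-split (suc i) j (rotateVec w) (cong suc i+j≡m) ⟩
  ∣ rotateVec w ∣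
    ≡⟨ ∣rotate∣ w ⟩
  ∣ w ∣ ∎
  where
  open ≡-Reasoning
  i+j≡m : i + j ≡ m
  i+j≡m = suc-injective (trans (sym (+-suc i j)) eq)
  letter : at (ρ w (suc j)) j ≡ at w m
  letter = trans
    (at-ρ 0 j (rotateVec w) (s≤s (m+n≤o⇒n≤o i (≤-reflexive i+j≡m))))
    (at-rotate-zero w)

-- The prefix count first exceeds `i` at the place of true letter number `i + 1`. The difference
-- formula is stated as a sum to stay within ℕ.
pos-prefix : ∀ i j (w : Vec Bool m) → j < m →
  𝟙 (pos (suc i) w ≡ᵇ suc j) + 𝟙 (i <ᵇ prefix j w) ≡ 𝟙 (i <ᵇ prefix (suc j) w)
pos-prefix zero    zero    (true  ∷ w) _ = refl
pos-prefix (suc i) zero    (true  ∷ w) _ with p , eq ← pos-suc i w rewrite eq = refl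
pos-prefix i       zero    (false ∷ w) _ with p , eq ← pos-suc i w rewrite eq = refl
pos-prefix zero    (suc j) (true  ∷ w) _ = refl
pos-prefix (suc i) (suc j) (true  ∷ w) (s<s j<m) = pos-prefix i j w j<m
pos-prefix i       (suc j) (false ∷ w) (s<s j<m) = pos-prefix i j w j<m

-- Winching on words

<ᵇ-true : ∀ {a b} → a < b → (a <ᵇ b) ≡ true
<ᵇ-true {a} {b} = dec-true (a <? b)

<ᵇ-false : ∀ {a b} → ¬ a < b → (a <ᵇ b) ≡ false
<ᵇ-false {a} {b} = dec-false (a <? b)

S-ext : {x y : S k m} → tuple x ≡ tuple y → x ≡ y
S-ext {x = mkS _ _} {mkS _ _} refl = refl

KSubset-ext : {A B : KSubset k m} → KSubset.set A ≡ KSubset.set B → A ≡ B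
KSubset-ext {A = mkKSubset _ _} {mkKSubset _ _} refl = refl

-- rank ν c is the time at which column c is winched; the value k outside the range
-- makes the boundary column k look as if it were winched last.
rank : Permutation′ k → ℕ → ℕ
rank {k} ν c with c <? k
... | yes c<k = toℕ (ν ⟨$⟩ˡ fromℕ< c<k)
... | no  _   = k

rank-toℕ : ∀ (ν : Permutation′ k) i → rank ν (toℕ i) ≡ toℕ (ν ⟨$⟩ˡ i)
rank-toℕ {k} ν i with toℕ i <? k
... | yes i<k = cong (λ j → toℕ (ν ⟨$⟩ˡ j)) (fromℕ<-toℕ i i<k)
... | no  i≮k = contradiction (toℕ<n i) i≮k

-- `c` ranges over all numbers so that the last column is also separated from the boundary column
-- `k`, whose rank exceeds every genuine time.
rank-injective : ∀ (ν : Permutation′ k) i c → rank ν (toℕ i) ≡ rank ν c → toℕ i ≡ c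
rank-injective {k} ν i c eq rewrite rank-toℕ ν i with c <? k
... | yes c<k = begin
  toℕ i                              ≡⟨ cong toℕ (inverseʳ ν) ⟨
  toℕ (ν ⟨$⟩ʳ (ν ⟨$⟩ˡ i))            ≡⟨ cong (toℕ ∘ (ν ⟨$⟩ʳ_)) (toℕ-injective eq) ⟩
  toℕ (ν ⟨$⟩ʳ (ν ⟨$⟩ˡ fromℕ< c<k))   ≡⟨ cong toℕ (inverseʳ ν) ⟩
  toℕ (fromℕ< c<k)                   ≡⟨ toℕ-fromℕ< c<k ⟩
  c                                  ∎
  where open ≡-Reasoning
... | no  _   = contradiction (subst (_< k) eq (toℕ<n (ν ⟨$⟩ˡ i))) (<-irrefl refl)

-- The boundary column `k` gets an offset too. Which rotation is read there is immaterial: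
-- `pos (suc k)` is `m + 1` on every word with `k` true letters.
offset : Permutation′ k → ℕ → ℕ
offset ν zero    = 0
offset ν (suc c) = offset ν c + 𝟙 (rank ν c <ᵇ rank ν (suc c))

-- The number of rotations behind column c at time p of the sweep.
stage : Permutation′ k → ℕ → ℕ → ℕ
stage ν p c = offset ν c + 𝟙 (rank ν c <ᵇ p)

-- The invariant of the sweep: all columns come from one word, each through its own number of
-- rotations.
ReadsFrom : (ℕ → ℕ) → Vec Bool m → Vec ℕ k → Set
ReadsFrom n w x = ∀ i → lookup x i ≡ pos (suc (toℕ i)) (ρ w (n (toℕ i)))

lookup-∷ʳ-last : ∀ (x : Vec ℕ k) v → lookup (x ∷ʳ v) (fromℕ k) ≡ v
lookup-∷ʳ-last []      v = refl
lookup-∷ʳ-last (_ ∷ x) v = lookup-∷ʳ-last x v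

-- The junk values of `pos` make both boundary entries fit the formula for columns. `pred` converts
-- a padded position into a column; at position 0 the choice is harmless, since `pos 0` is always 0.
lookup-pad-pos : ∀ n (w : Vec Bool m) (x : Vec ℕ k) → ∣ w ∣ ≡ k → ReadsFrom n w x →
  ∀ a → lookup (pad m x) a ≡ pos (toℕ a) (ρ w (n (pred (toℕ a))))
lookup-pad-pos n w x card r zero = refl
lookup-pad-pos {m} {k} n w x card r (suc a) with view a
... | ‵fromℕ rewrite toℕ-fromℕ k = trans (lookup-∷ʳ-last x (suc m))
        (sym (subst (λ c → pos (suc c) (ρ w (n k)) ≡ suc m)
                    (trans (∣ρ∣ w (n k)) card) (pos-end (ρ w (n k)))))
... | ‵inject₁ i rewrite toℕ-inject₁ i = trans (lookup-pad m x i) (r i)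

-- With the right neighbour one rotation ahead and the left neighbour level, the test in
-- `winchValue` succeeds exactly in the first case of `pos-rotate`.
winchValue-pos : ∀ n (w : Vec Bool m) (x : Vec ℕ k) → ∣ w ∣ ≡ k → ReadsFrom n w x →
  ∀ i → n (suc (toℕ i)) ≡ suc (n (toℕ i)) → n (pred (toℕ i)) ≡ n (toℕ i) →
  winchValue m i x ≡ pos (suc (toℕ i)) (ρ w (suc (n (toℕ i))))
winchValue-pos {m} {k} n w x card r i above below = begin
  winchValue m i x                  ≡⟨ value ⟩
  pos (suc (toℕ i)) (rotateVec v)   ≡⟨ cong (pos (suc (toℕ i))) (iterate-suc rotateVec w (n (toℕ i))) ⟨
  pos (suc (toℕ i)) (ρ w (suc (n (toℕ i)))) ∎
  where
  open ≡-Reasoning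
  v : Vec Bool m
  v = ρ w (n (toℕ i))
  next≡ : lookup (pad m x) (suc (suc i)) ≡ pos (2 + toℕ i) (rotateVec v)
  next≡ = trans (lookup-pad-pos n w x card r (suc (suc i)))
    (cong (pos (2 + toℕ i)) (trans (cong (ρ w) above) (iterate-suc rotateVec w (n (toℕ i)))))
  prev≡ : lookup (pad m x) (inject₁ (inject₁ i)) ≡ pos (toℕ i) v
  prev≡ = trans (lookup-pad-pos n w x card r (inject₁ (inject₁ i)))
    (trans (cong (λ c → pos c (ρ w (n (pred c)))) (trans (toℕ-inject₁ (inject₁ i)) (toℕ-inject₁ i)))
           (cong (pos (toℕ i) ∘ ρ w) below))
  value : winchValue m i x ≡ pos (suc (toℕ i)) (rotateVec v)
  value with suc (lookup x i) <? lookup (pad m x) (suc (suc i))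
           | pos-rotate v (subst (toℕ i <_) (sym (trans (∣ρ∣ w (n (toℕ i))) card)) (toℕ<n i))
  ... | yes _   | inj₁ (_ , y≡)  = trans (cong suc (r i)) (sym y≡)
  ... | no  _   | inj₂ (_ , y≡)  = trans (cong suc prev≡) (sym y≡)
  ... | yes lt  | inj₂ (z≡ , _)  = contradiction
          (subst₂ _<_ (cong suc (r i)) (trans next≡ z≡) lt) (<-irrefl refl)
  ... | no  ¬lt | inj₁ (lt , _)  = contradiction
          (subst₂ _<_ (cong suc (sym (r i))) (sym next≡) lt) ¬lt

-- The rule for invariants indexed by time. A general `c` in place of the identity lets the
-- induction drop the first index.
foldl-tabulate : ∀ {B C : Set} (P : ℕ → B → Set) (step : B → C → B) (c : Fin n → C) →
  (∀ i y → P (toℕ i) y → P (suc (toℕ i)) (step y (c i))) →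
  ∀ y → P 0 y → P n (foldl step y (List.tabulate c))
foldl-tabulate {zero}  P step c h y py = py
foldl-tabulate {suc n} P step c h y py =
  foldl-tabulate (P ∘ suc) step (c ∘ suc) (h ∘ suc) (step y (c zero)) (h zero y py)

-- When column c is winched, the column c + 1 is read from the word one rotation
-- ahead of column c, and the column c - 1 from the same word as column c.
stage-above : ∀ (ν : Permutation′ k) i →
  stage ν (rank ν (toℕ i)) (suc (toℕ i)) ≡ suc (stage ν (rank ν (toℕ i)) (toℕ i))
stage-above ν i with <-cmp (rank ν (toℕ i)) (rank ν (suc (toℕ i)))
-- A right neighbour still to be winched has an offset larger by one; one already winched has the
-- same offset but has gained a rotation in this sweep.
... | tri< lt _ gt rewrite <ᵇ-true lt | <ᵇ-false gt | <ᵇ-false (n≮n (rank ν (toℕ i))) =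
  trans (+-identityʳ _) (+-suc _ 0)
... | tri≈ _ eq _ = contradiction (rank-injective ν i _ eq) (λ e → 1+n≢n (sym e))
... | tri> lt _ gt rewrite <ᵇ-true gt | <ᵇ-false lt | <ᵇ-false (n≮n (rank ν (toℕ i))) =
  trans (+-suc _ 0) (cong suc (+-identityʳ _))

stage-below : ∀ (ν : Permutation′ k) c →
  stage ν (rank ν c) (pred c) ≡ stage ν (rank ν c) c
stage-below ν zero    = refl
-- `offset ν (suc c)` is by definition the stage that column `c` has reached when column `suc c` is
-- winched.
stage-below ν (suc c) rewrite <ᵇ-false (n≮n (rank ν (suc c))) = sym (+-identityʳ _)

stage-same : ∀ (ν : Permutation′ k) c → stage ν (suc (rank ν c)) c ≡ suc (stage ν (rank ν c) c)
stage-same ν c rewrite <ᵇ-true (n<1+n (rank ν c)) | <ᵇ-false (n≮n (rank ν c)) = +-suc _ 0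

stage-other : ∀ (ν : Permutation′ k) p c → rank ν c ≢ p → stage ν (suc p) c ≡ stage ν p c
stage-other ν p c ≢p with <-cmp (rank ν c) p
... | tri< lt _ _ rewrite <ᵇ-true lt | <ᵇ-true (m<n⇒m<1+n lt) = refl
... | tri≈ _ eq _ = contradiction eq ≢p
... | tri> ¬lt _ gt rewrite <ᵇ-false ¬lt | <ᵇ-false (≤⇒≯ gt) = refl

winch-stage : ∀ (ν : Permutation′ k) {w : Vec Bool m} → ∣ w ∣ ≡ k → ∀ i (y : S k m) →
  ReadsFrom (stage ν (toℕ i)) w (tuple y) →
  ReadsFrom (stage ν (suc (toℕ i))) w (tuple (winch (ν ⟨$⟩ʳ i) y))
winch-stage {k} {m} ν {w} card i y r j with ν ⟨$⟩ʳ i in νi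
-- The column winched at step `i` has rank `i`; by injectivity of the rank no other column changes
-- its stage.
... | c with rank-c ← trans (rank-toℕ ν c) (cong toℕ (trans (cong (ν ⟨$⟩ˡ_) (sym νi)) (inverseˡ ν)))
        with j Fin.≟ c
... | no j≢c = begin
  lookup (tuple (winch c y)) j
    ≡⟨ Vec.lookup∘update′ j≢c (tuple y) _ ⟩
  lookup (tuple y) j
    ≡⟨ r j ⟩
  pos (suc (toℕ j)) (ρ w (stage ν (toℕ i) (toℕ j)))
    ≡⟨ cong (pos (suc (toℕ j)) ∘ ρ w) (stage-other ν (toℕ i) (toℕ j)
         λ e → j≢c (toℕ-injective (rank-injective ν j (toℕ c) (trans e (sym rank-c))))) ⟨
  pos (suc (toℕ j)) (ρ w (stage ν (suc (toℕ i)) (toℕ j))) ∎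
  where open ≡-Reasoning
... | yes refl = begin
  lookup (tuple (winch c y)) c
    ≡⟨ Vec.lookup∘update c (tuple y) _ ⟩
  winchValue m c (tuple y)
    ≡⟨ winchValue-pos (stage ν (toℕ i)) w (tuple y) card r c
         (subst (λ p → stage ν p (suc (toℕ c)) ≡ suc (stage ν p (toℕ c))) rank-c (stage-above ν c))
         (subst (λ p → stage ν p (pred (toℕ c)) ≡ stage ν p (toℕ c)) rank-c (stage-below ν (toℕ c))) ⟩
  pos (suc (toℕ c)) (ρ w (suc (stage ν (toℕ i) (toℕ c))))
    ≡⟨ cong (pos (suc (toℕ c)) ∘ ρ w)
         (subst (λ p → stage ν (suc p) (toℕ c) ≡ suc (stage ν p (toℕ c))) rank-c (stage-same ν (toℕ c))) ⟨
  pos (suc (toℕ c)) (ρ w (stage ν (suc (toℕ i)) (toℕ c))) ∎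
  where open ≡-Reasoning

W-stage : ∀ (ν : Permutation′ k) {w : Vec Bool m} → ∣ w ∣ ≡ k → ∀ (y : S k m) →
  ReadsFrom (stage ν 0) w (tuple y) → ReadsFrom (stage ν k) w (tuple (W ν y))
W-stage ν {w} card =
  foldl-tabulate (λ p y → ReadsFrom (stage ν p) w (tuple y)) (λ y i → winch (ν ⟨$⟩ʳ i) y) id
    (winch-stage ν card)

readings : Permutation′ k → Vec Bool m → Vec ℕ k
readings ν w = tabulate λ i → pos (suc (toℕ i)) (ρ w (offset ν (toℕ i)))

readings-readsFrom : ∀ (ν : Permutation′ k) (w : Vec Bool m) → ReadsFrom (offset ν) w (readings ν w)
readings-readsFrom ν w = Vec.lookup∘tabulate _

-- Neighbouring columns are read from the same word or with the right one a rotation ahead, so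
-- `pos-<` or `pos-<-rotate` applies; the padding follows the same pattern.
readings-increasing : ∀ (ν : Permutation′ k) (w : Vec Bool m) → ∣ w ∣ ≡ k →
  Increasing (pad m (readings ν w))
readings-increasing {k} {m} ν w card a = subst₂ _<_
  (sym (trans (lookup-pad-pos (offset ν) w (readings ν w) card (readings-readsFrom ν w) (inject₁ a))
              (cong (λ c → pos c (ρ w (offset ν (pred c)))) (toℕ-inject₁ a))))
  (sym (lookup-pad-pos (offset ν) w (readings ν w) card (readings-readsFrom ν w) (suc a)))
  (step (toℕ a) (s≤s⁻¹ (toℕ<n a)))
  where
  step : ∀ c → c ≤ k → pos c (ρ w (offset ν (pred c))) < pos (suc c) (ρ w (offset ν c))
  step zero    _   = 0<pos-suc 0 w
  step (suc c) c<k with rank ν c <ᵇ rank ν (suc c)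
  ... | false rewrite +-identityʳ (offset ν c) =
    pos-< (ρ w (offset ν c)) (subst (suc c ≤_) (sym (trans (∣ρ∣ w (offset ν c)) card)) c<k)
  ... | true rewrite +-comm (offset ν c) 1 | iterate-suc rotateVec w (offset ν c) =
    pos-<-rotate (ρ w (offset ν c)) (subst (suc c ≤_) (sym (trans (∣ρ∣ w (offset ν c)) card)) c<k)

fromSubset : Permutation′ k → KSubset k m → S k m
fromSubset ν (mkKSubset w card) = mkS (readings ν w) (readings-increasing ν w card)

recompute-card : (A : KSubset k m) → ∣ KSubset.set A ∣ ≡ k
recompute-card {k} (mkKSubset w card) = recompute (∣ w ∣ ≟ k) card

-- A sweep takes every column from stage `offset` to stage `offset + 1`, which amounts to reading
-- the rotated word at the original offsets.
fromSubset-rotate : ∀ (ν : Permutation′ k) (A : KSubset k m) →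
  fromSubset ν (rotateSubset A) ≡ W ν (fromSubset ν A)
fromSubset-rotate {k} {m} ν A@(mkKSubset w card) = S-ext (begin
  readings ν (image next w)     ≡⟨ cong (readings ν) (image-next w) ⟩
  readings ν (rotateVec w)      ≡⟨ Vec.tabulate-cong column ⟩
  tabulate (lookup (tuple (W ν (fromSubset ν A)))) ≡⟨ Vec.tabulate∘lookup _ ⟩
  tuple (W ν (fromSubset ν A))  ∎)
  where
  open ≡-Reasoning
  start : ReadsFrom (stage ν 0) w (readings ν w)
  start i = trans (readings-readsFrom ν w i)
    (cong (pos (suc (toℕ i)) ∘ ρ w) (sym (+-identityʳ (offset ν (toℕ i)))))
  finish : ∀ i → stage ν k (toℕ i) ≡ suc (offset ν (toℕ i))
  finish i rewrite rank-toℕ ν i | <ᵇ-true (toℕ<n (ν ⟨$⟩ˡ i)) = +-comm _ 1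
  column : ∀ i → pos (suc (toℕ i)) (ρ w (suc (offset ν (toℕ i)))) ≡ lookup (tuple (W ν (fromSubset ν A))) i
  column i = trans (cong (pos (suc (toℕ i)) ∘ ρ w) (sym (finish i)))
    (sym (W-stage ν (recompute-card A) (fromSubset ν A) start i))

-- Orbits of periodic maps

Periodic : ℕ → (X → X) → Set
Periodic N σ = ∀ x → iterate σ x N ≡ x

module _ {σ : X → X} {N : ℕ} (period : Periodic N σ) where

  iterate-multiple : ∀ x q → iterate σ x (q * N) ≡ x
  iterate-multiple x zero    = refl
  iterate-multiple x (suc q) = trans (iterate-+ σ x N (q * N))
    (trans (cong (λ y → iterate σ y (q * N)) (period x)) (iterate-multiple x q))

  iterate-% : .{{_ : NonZero N}} → ∀ x n → iterate σ x (n % N) ≡ iterate σ x n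
  iterate-% x n = begin
    iterate σ x (n % N)                           ≡⟨ iterate-multiple _ (n ℕ./ N) ⟨
    iterate σ (iterate σ x (n % N)) (n ℕ./ N * N)   ≡⟨ iterate-+ σ x (n % N) (n ℕ./ N * N) ⟨
    iterate σ x (n % N + n ℕ./ N * N)               ≡⟨ cong (iterate σ x) (m≡m%n+[m/n]*n n N) ⟨
    iterate σ x n                                 ∎
    where open ≡-Reasoning

  iterate-return : .{{_ : NonZero N}} → ∀ x n → ∃[ l ] iterate σ (iterate σ x n) l ≡ x
  -- The witness completes `n` full periods.
  iterate-return x n = n * N ∸ n , (begin
    iterate σ (iterate σ x n) (n * N ∸ n)   ≡⟨ iterate-+ σ x n (n * N ∸ n) ⟨
    iterate σ x (n + (n * N ∸ n))           ≡⟨ cong (iterate σ x) (m+[n∸m]≡n (m≤m*n n N)) ⟩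
    iterate σ x (n * N)                     ≡⟨ iterate-multiple x n ⟩
    x                                       ∎)
    where open ≡-Reasoning

  -- The iterate of exponent `N - 1` is a left inverse of `σ`; `go` only exposes `N` as a successor.
  periodic⇒injective : .{{_ : NonZero N}} → Injective _≡_ _≡_ σ
  periodic⇒injective {x} {y} eq = go N refl
    where
    go : ∀ M .{{_ : NonZero M}} → M ≡ N → x ≡ y
    go (suc M) refl = trans (sym (period x)) (trans (cong (λ z → iterate σ z M) eq) (period y))

  -- Both lists are free of repetitions and have the same members, which makes them permutations of
  -- each other.
  orbit-map-↭ : .{{_ : NonZero N}} → (O : Orbit σ) → map σ (elements O) ↭ elements O
  orbit-map-↭ O = ∼bag⇒↭ (unique∧set⇒bag
    (Unique.map⁺ periodic⇒injective (Orbit.unique O)) (Orbit.unique O)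
    (λ {y} → mk⇔ (forth y) (back y)))
    where
    open Orbit O using (base; complete)
    forth : ∀ y → y ∈ map σ (elements O) → y ∈ elements O
    forth y y∈ with ∈-map⁻ σ y∈
    ... | x , x∈ , refl with Equivalence.to (complete x) x∈
    ...   | n , refl = Equivalence.from (complete _) (suc n , iterate-suc σ base n)
    back : ∀ y → y ∈ elements O → y ∈ map σ (elements O)
    back y y∈ with Equivalence.to (complete y) y∈
    -- Going on from the successor of `y` returns to `y`, so the point just before that return is a
    -- predecessor of `y` in the orbit.
    ... | n , refl with iterate-return (iterate σ base n) 1
    ...   | l , eq = subst (_∈ map σ (elements O))
      (trans (sym (iterate-suc σ _ l)) eq)
      (∈-map⁺ σ (Equivalence.from (complete _) (n + l , iterate-+ σ base n l)))

  module _ .{{_ : NonZero N}} (_≟_ : DecidableEquality X) where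

    -- `N` is some period, perhaps not the least one for `x`, so the first `N` iterates may repeat.
    orbitOf : X → Orbit σ
    orbitOf x = record
      { base     = x
      ; elements = deduplicate _≟_ (applyUpTo (iterate σ x) N)
      ; unique   = DecUnique.deduplicate-! _≟_ (applyUpTo (iterate σ x) N)
      ; complete = λ y → mk⇔
          (λ y∈ → let n , _ , y≡ = ∈-applyUpTo⁻ (iterate σ x) (∈-deduplicate⁻ _≟_ _ y∈) in n , sym y≡)
          (λ { (n , refl) → ∈-deduplicate⁺ _≟_ (subst (_∈ applyUpTo (iterate σ x) N) (iterate-% x n)
                              (∈-applyUpTo⁺ (iterate σ x) (m%n<n n N))) })
      }

    -- From a common point the period leads back to `x`, which would put `x` into `O`.
    orbit-disjoint : ∀ {x} (O : Orbit σ) → ¬ x ∈ elements O → Disjoint (elements (orbitOf x)) (elements O)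
    orbit-disjoint {x} O x∉ {y} (y∈x , y∈O)
      with Equivalence.to (Orbit.complete (orbitOf x) y) y∈x | Equivalence.to (Orbit.complete O y) y∈O
    ... | n , refl | l , eq with iterate-return x n
    ...   | r , back = x∉ (Equivalence.from (Orbit.complete O x)
      (l + r , trans (iterate-+ σ (Orbit.base O) l r) (trans (cong (λ z → iterate σ z r) eq) back)))

    -- Greedy choice: a point opens a new orbit only if the orbits found for the rest of the list
    -- miss it.
    collect : (xs : List X) → ∃[ os ]
      (AllPairs (λ O P → Disjoint (elements O) (elements P)) os ×
       (∀ {x} → x ∈ xs → Any (λ O → x ∈ elements {τ = σ} O) os))
    collect [] = [] , [] , λ ()
    collect (x ∷ xs) with collect xs
    ... | os , dis , cov with any? (λ O → any? (x ≟_) (elements O)) os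
    ...   | yes x∈os = os , dis , λ { (here refl) → x∈os ; (there y∈) → cov y∈ }
    ...   | no  x∉os = orbitOf x ∷ os
                     , All.map (λ {O} → orbit-disjoint O) (All.¬Any⇒All¬ os x∉os) ∷ dis
                     , λ { (here refl) → here (Equivalence.from (Orbit.complete (orbitOf x) x) (0 , refl))
                         ; (there y∈)  → there (cov y∈) }

    orbitPartition : (xs : List X) → (∀ x → x ∈ xs) → OrbitPartition σ
    orbitPartition xs all = let os , dis , cov = collect xs in record
      { orbits = os ; disjoint = dis ; covers = λ x → cov (all x) }

-- Transport of orbits along a conjugacy

record Conjugacy {X Y : Set} (σ : X → X) (τ : Y → Y) : Set where
  field
    to         : X → Y
    injective  : Injective _≡_ _≡_ to
    surjective : ∀ y → ∃[ x ] to x ≡ y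
    commutes   : ∀ x → to (σ x) ≡ τ (to x)

  to-iterate : ∀ x n → to (iterate σ x n) ≡ iterate τ (to x) n
  to-iterate x zero    = refl
  to-iterate x (suc n) = trans (to-iterate (σ x) n) (cong (λ y → iterate τ y n) (commutes x))

  periodic : ∀ {N} → Periodic N σ → Periodic N τ
  periodic {N} period y with surjective y
  ... | x , refl = trans (sym (to-iterate x N)) (cong to (period x))

  mapOrbit : Orbit σ → Orbit τ
  mapOrbit O = record
    { base     = to base
    ; elements = map to (elements O)
    ; unique   = Unique.map⁺ injective unique
    ; complete = λ y → mk⇔ (forth y)
        λ { (n , refl) → subst (_∈ map to (elements O)) (to-iterate base n)
                           (∈-map⁺ to (Equivalence.from (complete _) (n , refl))) }
    }
    where
    open Orbit O using (base; unique; complete)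
    forth : ∀ y → y ∈ map to (elements O) → ∃[ n ] iterate τ (to base) n ≡ y
    forth y y∈ with ∈-map⁻ to y∈
    ... | x , x∈ , refl with Equivalence.to (complete x) x∈
    ...   | n , refl = n , sym (to-iterate base n)

  mapOrbit-disjoint : ∀ {O P} → Disjoint (elements O) (elements P) →
    Disjoint (elements (mapOrbit O)) (elements (mapOrbit P))
  mapOrbit-disjoint {O} {P} dis (y∈O , y∈P) with ∈-map⁻ to y∈O | ∈-map⁻ to y∈P
  ... | x , x∈O , refl | x′ , x′∈P , eq =
    dis (x∈O , subst (_∈ elements P) (sym (injective eq)) x′∈P)

  mapPartition : OrbitPartition σ → OrbitPartition τ
  mapPartition P = record
    { orbits   = map mapOrbit orbits
    ; disjoint = AllPairs.map⁺ (AllPairs.map (λ {O} {P} → mapOrbit-disjoint {O} {P}) disjoint)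
    ; covers   = λ y → let x , eq = surjective y in
        Any.map⁺ (Any.map (λ x∈ → subst (_∈ _) eq (∈-map⁺ to x∈)) (covers x))
    }
    where open OrbitPartition P

  sizes-mapPartition : ∀ P → OrbitPartition.sizes (mapPartition P) ≡ OrbitPartition.sizes P
  sizes-mapPartition P = trans (sym (map-∘ orbits)) (map-cong (λ O → length-map to (elements O)) orbits)
    where open OrbitPartition P

open Conjugacy using (mapPartition; sizes-mapPartition)

conjugate⇒sameOrbitStructure : {σ : X → X} {τ : Y → Y} →
  Conjugacy σ τ → OrbitPartition σ → SameOrbitStructure τ σ
conjugate⇒sameOrbitStructure c P = mapPartition c P , P , ↭-reflexive (sizes-mapPartition c P)

conjugates⇒sameOrbitStructure : {σ : X → X} {τ : Y → Y} {υ : Z → Z} →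
  Conjugacy σ τ → Conjugacy σ υ → OrbitPartition σ → SameOrbitStructure τ υ
conjugates⇒sameOrbitStructure c e P =
  mapPartition c P , mapPartition e P ,
  ↭-reflexive (trans (sizes-mapPartition c P) (sym (sizes-mapPartition e P)))

iterate-injective : {φ : X → X} → Injective _≡_ _≡_ φ → ∀ n → Injective _≡_ _≡_ (λ x → iterate φ x n)
iterate-injective inj zero    eq = eq
iterate-injective inj (suc n) eq = inj (iterate-injective inj n eq)

-- Pigeonhole on the iterates of y yields y = φⁿ y with n > 0.
injective⇒surjective : (xs : List X) → (∀ x → x ∈ xs) → (φ : X → X) → Injective _≡_ _≡_ φ →
  ∀ y → ∃[ x ] φ x ≡ y
injective⇒surjective xs all φ inj y
  with pigeonhole (n<1+n (length xs)) (λ i → index (all (iterate φ y (toℕ i))))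
... | i , j , i<j , eq = iterate φ y gap , trans (sym (iterate-suc φ y gap)) (iterate-injective inj (toℕ i) (begin
    iterate φ (iterate φ y (suc gap)) (toℕ i)   ≡⟨ iterate-+ φ y (suc gap) (toℕ i) ⟨
    iterate φ y (suc gap + toℕ i)               ≡⟨ cong (iterate φ y) (trans (sym (+-suc gap (toℕ i))) (m∸n+n≡m i<j)) ⟩
    iterate φ y (toℕ j)                       ≡⟨ found (toℕ j) ⟩
    List.lookup xs (index (all (iterate φ y (toℕ j)))) ≡⟨ cong (List.lookup xs) eq ⟨
    List.lookup xs (index (all (iterate φ y (toℕ i)))) ≡⟨ found (toℕ i) ⟨
    iterate φ y (toℕ i)                       ∎))
  where
  open ≡-Reasoning
  -- One less than the distance between the colliding exponents, so that the preimage stops one step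
  -- short of the return to `y`.
  gap = toℕ j ∸ suc (toℕ i)
  found : ∀ n → iterate φ y n ≡ List.lookup xs (index (all (iterate φ y n)))
  found n = Any.lookup-index (all (iterate φ y n))

-- Enumeration of the k-subsets

consFalse : KSubset k m → KSubset k (suc m)
consFalse (mkKSubset w card) = mkKSubset (false ∷ w) card

consTrue : KSubset k m → KSubset (suc k) (suc m)
consTrue (mkKSubset w card) = mkKSubset (true ∷ w) (cong suc card)

allSubsets : ∀ k m → List (KSubset k m)
allSubsets zero    zero    = mkKSubset [] refl ∷ []
allSubsets (suc k) zero    = []
allSubsets zero    (suc m) = map consFalse (allSubsets zero m)
allSubsets (suc k) (suc m) = map consFalse (allSubsets (suc k) m) ++ map consTrue (allSubsets k m)

∈-allSubsets : ∀ {k m} (A : KSubset k m) → A ∈ allSubsets k m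
∈-allSubsets {zero}  {zero}  (mkKSubset [] _) = here refl
∈-allSubsets {suc k} {zero}  (mkKSubset [] c) = contradiction (recompute (0 ≟ suc k) c) λ ()
∈-allSubsets {zero}  {suc m} (mkKSubset (true ∷ w) c) = contradiction (recompute (suc ∣ w ∣ ≟ 0) c) λ ()
∈-allSubsets {zero}  {suc m} (mkKSubset (false ∷ w) c) = ∈-map⁺ consFalse (∈-allSubsets (mkKSubset w c))
∈-allSubsets {suc k} {suc m} (mkKSubset (false ∷ w) c) = ∈-++⁺ˡ (∈-map⁺ consFalse (∈-allSubsets (mkKSubset w c)))
∈-allSubsets {suc k} {suc m} (mkKSubset (true ∷ w) c) =
  ∈-++⁺ʳ _ (∈-map⁺ consTrue (∈-allSubsets (mkKSubset w (suc-injective c))))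

-- The conjugacies with rotation

set-iterate : ∀ (A : KSubset k m) n → set (iterate rotateSubset A n) ≡ ρ (set A) n
set-iterate A zero    = refl
set-iterate A (suc n) = trans (set-iterate (rotateSubset A) n) (cong (λ w → ρ w n) (image-next (set A)))

rotateSubset-periodic : Periodic m (rotateSubset {k} {m})
rotateSubset-periodic {m} A = KSubset-ext (trans (set-iterate A m) (ρ-period (set A)))

at-zero-pos : (w : Vec Bool (suc n)) → at w 0 ≡ (pos 1 w ≡ᵇ 1)
at-zero-pos (true  ∷ w) = refl
at-zero-pos (false ∷ w) with p , eq ← pos-suc 0 w rewrite eq = refl

fromSubset-iterate : ∀ (ν : Permutation′ k) (A : KSubset k m) n →
  fromSubset ν (iterate rotateSubset A n) ≡ iterate (W ν) (fromSubset ν A) n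
fromSubset-iterate ν A zero    = refl
fromSubset-iterate ν A (suc n) = trans (fromSubset-iterate ν (rotateSubset A) n)
  (cong (λ x → iterate (W ν) x n) (fromSubset-rotate ν A))

-- The first column of the n-th iterate tells whether the n-th rotation starts with true.
fromSubset-injective : (ν : Permutation′ (suc k)) → Injective _≡_ _≡_ (fromSubset {suc k} {m} ν)
fromSubset-injective {k} {zero} ν {mkKSubset [] _} {mkKSubset [] _} _ = refl
fromSubset-injective {k} {suc m} ν {A} {B} eq = KSubset-ext (at-extensional (set A) (set B) λ j j<m → begin
  at (set A) j                        ≡⟨ at-zero-ρ (set A) j<m ⟨
  at (ρ (set A) (suc m ∸ j)) 0        ≡⟨ heads (suc m ∸ j) ⟩
  at (ρ (set B) (suc m ∸ j)) 0        ≡⟨ at-zero-ρ (set B) j<m ⟩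
  at (set B) j                        ∎)
  where
  open ≡-Reasoning
  firstColumn : ∀ C n → pos 1 (ρ (set C) n) ≡ lookup (tuple (iterate (W ν) (fromSubset ν C) n)) zero
  firstColumn C n = trans (cong (pos 1) (sym (set-iterate C n)))
    (cong (λ x → lookup (tuple x) zero) (fromSubset-iterate ν C n))
  heads : ∀ n → at (ρ (set A) n) 0 ≡ at (ρ (set B) n) 0
  heads n = begin
    at (ρ (set A) n) 0                ≡⟨ at-zero-pos (ρ (set A) n) ⟩
    (pos 1 (ρ (set A) n) ≡ᵇ 1)        ≡⟨ cong (_≡ᵇ 1) (trans (firstColumn A n)
                                           (trans (cong (λ x → lookup (tuple (iterate (W ν) x n)) zero) eq)
                                                  (sym (firstColumn B n)))) ⟩
    (pos 1 (ρ (set B) n) ≡ᵇ 1)        ≡⟨ at-zero-pos (ρ (set B) n) ⟨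
    at (ρ (set B) n) 0                ∎

-- The set of entries of a tuple, and surjectivity of the conjugating map

Chain : ℕ → Vec ℕ k → ℕ → Set
Chain lo []       hi = lo < hi
Chain lo (x ∷ xs) hi = lo < x × Chain x xs hi

increasing⇒chain : ∀ lo (xs : Vec ℕ k) hi → Increasing (lo ∷ (xs ∷ʳ hi)) → Chain lo xs hi
increasing⇒chain lo []       hi inc = inc zero
increasing⇒chain lo (x ∷ xs) hi inc = inc zero , increasing⇒chain x xs hi (inc ∘ suc)

chain⇒< : ∀ {lo hi} (xs : Vec ℕ k) → Chain lo xs hi → lo < hi
chain⇒< []       lo<hi       = lo<hi
chain⇒< (x ∷ xs) (lo<x , ch) = <-trans lo<x (chain⇒< xs ch)

-- Letter j (counted from 1) tells whether lo + j occurs in xs, provided xs increases from above lo.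
indicator : ∀ n → ℕ → Vec ℕ k → Vec Bool n
indicator zero    lo xs       = []
indicator (suc n) lo []       = false ∷ indicator n (suc lo) []
indicator (suc n) lo (x ∷ xs) with x ≟ suc lo
... | yes _ = true  ∷ indicator n (suc lo) xs
... | no  _ = false ∷ indicator n (suc lo) (x ∷ xs)

-- The chain confines the entries to the window from `lo + 1` to `lo + n`, so the scan meets each of
-- them; an empty window has no room for an entry.
∣indicator∣ : ∀ n lo (xs : Vec ℕ k) → Chain lo xs (suc (lo + n)) → ∣ indicator n lo xs ∣ ≡ k
∣indicator∣ zero    lo []       _ = refl
∣indicator∣ zero    lo (x ∷ xs) (lo<x , ch) =
  contradiction (s≤s⁻¹ (chain⇒< xs ch)) (<⇒≱ (subst (_< x) (sym (+-identityʳ lo)) lo<x))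
∣indicator∣ (suc n) lo []       _ = ∣indicator∣ n (suc lo) [] (s≤s (s≤s (m≤m+n lo n)))
∣indicator∣ (suc n) lo (x ∷ xs) (lo<x , ch) rewrite +-suc lo n with x ≟ suc lo
... | yes refl = cong suc (∣indicator∣ n (suc lo) xs ch)
... | no  x≢   = ∣indicator∣ n (suc lo) (x ∷ xs) (≤∧≢⇒< lo<x (x≢ ∘ sym) , ch)

-- Positions of true letters give the entries back, so no information is lost; `support-injective`
-- rests on this.
pos-indicator : ∀ n lo (xs : Vec ℕ k) → Chain lo xs (suc (lo + n)) → ∀ i →
  lo + pos (suc (toℕ i)) (indicator n lo xs) ≡ lookup xs i
pos-indicator zero    lo (x ∷ xs) (lo<x , ch) i =
  contradiction (s≤s⁻¹ (chain⇒< xs ch)) (<⇒≱ (subst (_< x) (sym (+-identityʳ lo)) lo<x))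
pos-indicator (suc n) lo (x ∷ xs) (lo<x , ch) i rewrite +-suc lo n with x ≟ suc lo
pos-indicator (suc n) lo (x ∷ xs) (lo<x , ch) zero    | yes refl = trans (+-suc lo 0) (cong suc (+-identityʳ lo))
pos-indicator (suc n) lo (x ∷ xs) (lo<x , ch) (suc i) | yes refl =
  trans (+-suc lo _) (pos-indicator n (suc lo) xs ch i)
pos-indicator (suc n) lo (x ∷ xs) (lo<x , ch) i       | no x≢ =
  trans (+-suc lo _) (pos-indicator n (suc lo) (x ∷ xs) (≤∧≢⇒< lo<x (x≢ ∘ sym) , ch) i)

S-chain : ∀ {m} {xs : Vec ℕ k} → Increasing (pad m xs) → Chain 0 xs (suc m)
S-chain {m = m} {xs} = increasing⇒chain 0 xs (suc m)

support : S k m → KSubset k m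
support {m = m} (mkS xs inc) = mkKSubset (indicator m 0 xs) (∣indicator∣ m 0 xs (S-chain inc))

support-injective : Injective _≡_ _≡_ (support {k} {m})
support-injective {k} {m} {mkS xs inc} {mkS ys inc′} eq =
  -- The proofs of increase are irrelevant; decidable equality of vectors allows the equation to be
  -- derived from them.
  S-ext (recompute (Vec.≡-dec _≟_ xs ys) (begin
    xs                                                       ≡⟨ Vec.tabulate∘lookup xs ⟨
    tabulate (lookup xs)                                     ≡⟨ Vec.tabulate-cong (pos-indicator m 0 xs (S-chain inc)) ⟨
    tabulate (λ i → pos (suc (toℕ i)) (indicator m 0 xs))    ≡⟨ cong (λ w → tabulate λ i → pos (suc (toℕ i)) w) (cong set eq) ⟩
    tabulate (λ i → pos (suc (toℕ i)) (indicator m 0 ys))    ≡⟨ Vec.tabulate-cong (pos-indicator m 0 ys (S-chain inc′)) ⟩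
    tabulate (lookup ys)                                     ≡⟨ Vec.tabulate∘lookup ys ⟩
    ys                                                       ∎))
  where open ≡-Reasoning

-- Composition with `support` gives an injective self-map of the finite set of k-subsets, hence a
-- surjective one, and injectivity of `support` strips it off again.
fromSubset-surjective : ∀ (ν : Permutation′ (suc k)) (x : S (suc k) m) → ∃[ A ] fromSubset ν A ≡ x
fromSubset-surjective {k} {m} ν x =
  let A , eq = injective⇒surjective (allSubsets (suc k) m) ∈-allSubsets (support ∘ fromSubset ν)
                 (fromSubset-injective ν ∘ support-injective) (support x)
  in A , support-injective eq

winching-conjugacy : (ν : Permutation′ (suc k)) → Conjugacy (rotateSubset {suc k} {m}) (W ν)
winching-conjugacy ν = record
  { to         = fromSubset ν
  ; injective  = fromSubset-injective ν
  ; surjective = fromSubset-surjective ν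
  ; commutes   = fromSubset-rotate ν
  }

-- Necklaces as coloured words

colour : Bool → Colour
colour true  = white
colour false = black

isWhite : Colour → Bool
isWhite white = true
isWhite black = false

isWhite-colour : ∀ b → isWhite (colour b) ≡ b
isWhite-colour true  = refl
isWhite-colour false = refl

colour-isWhite : ∀ c → colour (isWhite c) ≡ c
colour-isWhite white = refl
colour-isWhite black = refl

whites-colour : (w : Vec Bool m) → count (_≟ᶜ white) (Vec.map colour w) ≡ ∣ w ∣
whites-colour []          = refl
whites-colour (true  ∷ w) = cong suc (whites-colour w)
whites-colour (false ∷ w) = whites-colour w

whites+blacks : (c : Vec Colour m) → count (_≟ᶜ white) c + count (_≟ᶜ black) c ≡ m
whites+blacks []          = refl
whites+blacks (white ∷ c) = cong suc (whites+blacks c)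
whites+blacks (black ∷ c) = trans (+-suc _ _) (cong suc (whites+blacks c))

blacks-colour : (w : Vec Bool m) → count (_≟ᶜ black) (Vec.map colour w) ≡ m ∸ ∣ w ∣
blacks-colour {m} w = begin
  blacks                    ≡⟨ m+n∸m≡n ∣ w ∣ blacks ⟨
  ∣ w ∣ + blacks ∸ ∣ w ∣    ≡⟨ cong (λ n → n + blacks ∸ ∣ w ∣) (whites-colour w) ⟨
  count (_≟ᶜ white) (Vec.map colour w) + blacks ∸ ∣ w ∣ ≡⟨ cong (_∸ ∣ w ∣) (whites+blacks (Vec.map colour w)) ⟩
  m ∸ ∣ w ∣                 ∎
  where
  open ≡-Reasoning
  blacks = count (_≟ᶜ black) (Vec.map colour w)

rotateVec-map : {X Y : Set} (φ : X → Y) (xs : Vec X m) → rotateVec (Vec.map φ xs) ≡ Vec.map φ (rotateVec xs)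
rotateVec-map {zero}  φ [] = refl
rotateVec-map {suc m} φ xs with initLast xs
... | ys , y , refl rewrite Vec.map-∷ʳ φ y ys = cong₂ _∷_ (Vec.last-∷ʳ (φ y) (Vec.map φ ys)) (Vec.init-∷ʳ (φ y) (Vec.map φ ys))

Necklace-ext : {c e : Necklace k m} → Necklace.beads c ≡ Necklace.beads e → c ≡ e
Necklace-ext {c = mkNecklace _ _ _} {mkNecklace _ _ _} refl = refl

map-inverse : {X Y : Set} {φ : X → Y} {ψ : Y → X} → (∀ x → ψ (φ x) ≡ x) →
  (xs : Vec X m) → Vec.map ψ (Vec.map φ xs) ≡ xs
map-inverse {φ = φ} {ψ} inv xs =
  trans (sym (Vec.map-∘ ψ φ xs)) (trans (Vec.map-cong inv xs) (Vec.map-id xs))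

necklace-conjugacy : Conjugacy (rotateSubset {k} {m}) (rotateNecklace {k} {m})
necklace-conjugacy {k} {m} = record
  { to         = to
  ; injective  = λ {A} {B} eq → KSubset-ext (trans (sym (map-inverse isWhite-colour (set A)))
      (trans (cong (Vec.map isWhite ∘ Necklace.beads) eq) (map-inverse isWhite-colour (set B))))
  ; surjective = λ { (mkNecklace c w b) →
      mkKSubset (Vec.map isWhite c)
        (trans (sym (whites-colour (Vec.map isWhite c)))
          (trans (cong (count (_≟ᶜ white)) (map-inverse colour-isWhite c)) w))
      , Necklace-ext (map-inverse colour-isWhite c) }
  ; commutes   = λ A → Necklace-ext (trans (cong (Vec.map colour) (image-next (set A)))
      (sym (rotateVec-map colour (set A))))
  }
  where
  to : KSubset k m → Necklace k m
  to (mkKSubset w card) = mkNecklace (Vec.map colour w)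
    (trans (whites-colour w) card) (trans (blacks-colour w) (cong (m ∸_) card))

-- Orbit sums

total : List X → (X → ℕ) → ℕ
total xs φ = sum (map φ xs)

total-cong : ∀ {φ ψ : X → ℕ} xs → (∀ x → φ x ≡ ψ x) → total xs φ ≡ total xs ψ
total-cong xs eq = cong sum (map-cong eq xs)

total-congᴬ : ∀ {φ ψ : X → ℕ} {xs} → All (λ x → φ x ≡ ψ x) xs → total xs φ ≡ total xs ψ
total-congᴬ []         = refl
total-congᴬ (eq ∷ eqs) = cong₂ _+_ eq (total-congᴬ eqs)

total-+ : ∀ (φ ψ : X → ℕ) xs → total xs (λ x → φ x + ψ x) ≡ total xs φ + total xs ψ
total-+ φ ψ []       = refl
total-+ φ ψ (x ∷ xs) rewrite total-+ φ ψ xs =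
  interchange (φ x) (ψ x) (total xs φ) (total xs ψ)

total-const : ∀ (xs : List X) c → total xs (λ _ → c) ≡ length xs * c
total-const []       c = refl
total-const (x ∷ xs) c = cong (c +_) (total-const xs c)

total-tabulate : ∀ n (φ : Fin n → X → ℕ) xs →
  total xs (λ x → sum (List.tabulate λ i → φ i x)) ≡ sum (List.tabulate λ i → total xs (φ i))
total-tabulate zero    φ xs = trans (total-const xs 0) (*-zeroʳ (length xs))
total-tabulate (suc n) φ xs = trans (total-+ (φ zero) _ xs)
  (cong (total xs (φ zero) +_) (total-tabulate n (φ ∘ suc) xs))

sum-tabulate-cong : ∀ {φ ψ : Fin n → ℕ} → (∀ i → φ i ≡ ψ i) → sum (List.tabulate φ) ≡ sum (List.tabulate ψ)
sum-tabulate-cong {zero}  eq = refl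
sum-tabulate-cong {suc n} eq = cong₂ _+_ (eq zero) (sum-tabulate-cong (eq ∘ suc))

sum-tabulate-+ : ∀ (φ ψ : Fin n → ℕ) →
  sum (List.tabulate λ i → φ i + ψ i) ≡ sum (List.tabulate φ) + sum (List.tabulate ψ)
sum-tabulate-+ {zero}  φ ψ = refl
sum-tabulate-+ {suc n} φ ψ rewrite sum-tabulate-+ (φ ∘ suc) (ψ ∘ suc) =
  interchange (φ zero) (ψ zero) _ _

sum-<ᵇ : ∀ {p} → p ≤ n → sum (List.tabulate {n = n} λ i → 𝟙 (toℕ i <ᵇ p)) ≡ p
sum-<ᵇ {zero}          z≤n       = refl
sum-<ᵇ {suc n}         z≤n       = sum-<ᵇ {n} z≤n
sum-<ᵇ {suc n} {suc p} (s≤s p≤n) = cong suc (sum-<ᵇ p≤n)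

-- If both inequalities held, `x + y` would be at least `i + i′ + 2`; if neither did, at most
-- `i + i′`.
𝟙-complement : ∀ i i′ x y → x + y ≡ suc (i + i′) → 𝟙 (i′ <ᵇ x) + 𝟙 (i <ᵇ y) ≡ 1
𝟙-complement i i′ x y eq = decide (i′ <? x)
  where
  open ≤-Reasoning
  both : i′ < x → ¬ i < y
  both i′<x i<y = <-irrefl (sym eq) (begin-strict
    suc (i + i′) ≡⟨ cong suc (+-comm i i′) ⟩
    suc i′ + i   <⟨ +-mono-≤-< i′<x i<y ⟩
    x + y        ∎)
  neither : ¬ i′ < x → i < y
  neither i′≮x = +-cancelˡ-< i′ i y (begin-strict
    i′ + i       <⟨ n<1+n (i′ + i) ⟩
    suc (i′ + i) ≡⟨ cong suc (+-comm i′ i) ⟩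
    suc (i + i′) ≡⟨ eq ⟨
    x + y        ≤⟨ +-monoˡ-≤ y (≮⇒≥ i′≮x) ⟩
    i′ + y       ∎)
  decide : Dec (i′ < x) → 𝟙 (i′ <ᵇ x) + 𝟙 (i <ᵇ y) ≡ 1
  decide (yes i′<x) rewrite <ᵇ-true i′<x  | <ᵇ-false (both i′<x)   = refl
  decide (no  i′≮x) rewrite <ᵇ-false i′≮x | <ᵇ-true (neither i′≮x) = refl

-- Isolates what the sums use of an orbit: a multiset of words closed under rotation, with `k` true
-- letters in each.
module RotationInvariant (ws : List (Vec Bool m)) (rotated : map rotateVec ws ↭ ws)
                         (card : All (λ w → ∣ w ∣ ≡ k) ws) where

  total-rotate : ∀ φ → total ws (φ ∘ rotateVec) ≡ total ws φ
  total-rotate φ = trans (cong sum (map-∘ ws)) (sum-↭ (map⁺ φ rotated))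

  -- Through this the offsets, and with them the dependence on `ν`, vanish from the orbit sums.
  total-ρ : ∀ φ n → total ws (λ w → φ (ρ w n)) ≡ total ws φ
  total-ρ φ zero    = refl
  total-ρ φ (suc n) = trans (total-rotate (λ w → φ (ρ w n))) (total-ρ φ n)

  occurrences : ℕ → ℕ → ℕ
  occurrences i j = total ws λ w → 𝟙 (pos (suc i) w ≡ᵇ suc j)

  exceeding : ℕ → ℕ → ℕ
  exceeding i j = total ws λ w → 𝟙 (i <ᵇ prefix j w)

  occurrences-exceeding : ∀ i {j} → j < m → occurrences i j + exceeding i j ≡ exceeding i (suc j)
  occurrences-exceeding i {j} j<m = trans
    (sym (total-+ (λ w → 𝟙 (pos (suc i) w ≡ᵇ suc j)) _ ws))
    (total-cong ws λ w → pos-prefix i j w j<m)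

  -- By invariance the second sum may count the last `b` letters instead of the first `b`. With the
  -- first `a` letters they contain `i + i′ + 1` true ones, so each word contributes exactly 1.
  exceeding-complement : ∀ i i′ a b → suc (i + i′) ≡ k → a + b ≡ m →
    exceeding i′ a + exceeding i b ≡ length ws
  exceeding-complement i i′ a b eqk eqm = begin
    exceeding i′ a + exceeding i b
      ≡⟨ cong (exceeding i′ a +_) (total-ρ (λ w → 𝟙 (i <ᵇ prefix b w)) b) ⟨
    exceeding i′ a + total ws (λ w → 𝟙 (i <ᵇ prefix b (ρ w b)))
      ≡⟨ total-+ (λ w → 𝟙 (i′ <ᵇ prefix a w)) _ ws ⟨
    total ws (λ w → 𝟙 (i′ <ᵇ prefix a w) + 𝟙 (i <ᵇ prefix b (ρ w b)))
      ≡⟨ total-congᴬ (All.map (λ {w} c → 𝟙-complement i i′ (prefix a w) (prefix b (ρ w b))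
           (trans (prefix-split a b w eqm) (trans c (sym eqk)))) card) ⟩
    total ws (λ _ → 1)
      ≡⟨ trans (total-const ws 1) (*-identityʳ (length ws)) ⟩
    length ws ∎
    where open ≡-Reasoning

  occurrences-symmetric : ∀ i i′ j j′ → suc (i + i′) ≡ k → suc (j + j′) ≡ m →
    occurrences i j ≡ occurrences i′ j′
  occurrences-symmetric i i′ j j′ eqk eqm =
    -- Adding both `exceeding` terms avoids subtraction: each side becomes `length ws`, from the
    -- splits of `m` as `j′ + (j + 1)` and `(j′ + 1) + j`.
    +-cancelʳ-≡ (exceeding i j + exceeding i′ j′) _ _ (begin
      occurrences i j + (exceeding i j + exceeding i′ j′)
        ≡⟨ +-assoc (occurrences i j) _ _ ⟨
      occurrences i j + exceeding i j + exceeding i′ j′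
        ≡⟨ cong (_+ exceeding i′ j′) (occurrences-exceeding i (m+n≤o⇒m≤o (suc j) (≤-reflexive eqm))) ⟩
      exceeding i (suc j) + exceeding i′ j′
        ≡⟨ +-comm (exceeding i (suc j)) _ ⟩
      exceeding i′ j′ + exceeding i (suc j)
        ≡⟨ exceeding-complement i i′ j′ (suc j) eqk (trans (+-comm j′ (suc j)) eqm) ⟩
      length ws
        ≡⟨ exceeding-complement i i′ (suc j′) j eqk (trans (cong suc (+-comm j′ j)) eqm) ⟨
      exceeding i′ (suc j′) + exceeding i j
        ≡⟨ cong (_+ exceeding i j) (occurrences-exceeding i′ (subst (j′ <_) eqm (s≤s (m≤n+m j′ j)))) ⟨
      occurrences i′ j′ + exceeding i′ j′ + exceeding i j
        ≡⟨ +-assoc (occurrences i′ j′) _ _ ⟩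
      occurrences i′ j′ + (exceeding i′ j′ + exceeding i j)
        ≡⟨ cong (occurrences i′ j′ +_) (+-comm (exceeding i′ j′) _) ⟩
      occurrences i′ j′ + (exceeding i j + exceeding i′ j′) ∎)
    where open ≡-Reasoning

  finalTrues : ℕ
  finalTrues = total ws λ w → 𝟙 (at w (pred m))

  -- Rotation puts the last letter in front of the prefix, so each lengthening by one adds the same
  -- amount.
  total-prefix-suc : ∀ {j} → j < m →
    total ws (prefix (suc j)) ≡ finalTrues + total ws (prefix j)
  total-prefix-suc {j} j<m = begin
    total ws (prefix (suc j))                               ≡⟨ total-rotate (prefix (suc j)) ⟨
    total ws (prefix (suc j) ∘ rotateVec)                   ≡⟨ total-cong ws (prefix-rotate′ j<m) ⟩
    total ws (λ w → 𝟙 (at w (pred m)) + prefix j w)         ≡⟨ total-+ (λ w → 𝟙 (at w (pred m))) _ ws ⟩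
    finalTrues + total ws (prefix j)                        ∎
    where
    open ≡-Reasoning
    prefix-rotate′ : ∀ {m j} → j < m → (w : Vec Bool m) →
      prefix (suc j) (rotateVec w) ≡ 𝟙 (at w (pred m)) + prefix j w
    prefix-rotate′ {suc m} (s≤s j≤m) w = prefix-rotate w j≤m

  total-prefix : ∀ j → j ≤ m → total ws (prefix j) ≡ j * finalTrues
  total-prefix zero    _   = trans (total-const ws 0) (*-zeroʳ (length ws))
  total-prefix (suc j) j<m = trans (total-prefix-suc j<m) (cong (finalTrues +_) (total-prefix j (<⇒≤ j<m)))

  -- Counts all true letters twice, by place and by word.
  m*finalTrues : m * finalTrues ≡ length ws * k
  m*finalTrues = begin
    m * finalTrues         ≡⟨ total-prefix m ≤-refl ⟨
    total ws (prefix m)    ≡⟨ total-congᴬ (All.map (λ {w} c → trans (prefix-full w) c) card) ⟩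
    total ws (λ _ → k)     ≡⟨ total-const ws k ⟩
    length ws * k          ∎
    where open ≡-Reasoning

  sum-exceeding : ∀ j → sum (List.tabulate {n = k} λ i → exceeding (toℕ i) j) ≡ total ws (prefix j)
  sum-exceeding j = trans (sym (total-tabulate k (λ i w → 𝟙 (toℕ i <ᵇ prefix j w)) ws))
    (total-congᴬ (All.map (λ {w} c → sum-<ᵇ (subst (prefix j w ≤_) c (prefix-≤ j w))) card))

  -- Summed over the columns, the difference formula leaves the difference of two consecutive prefix
  -- totals.
  sum-occurrences : ∀ {j} → j < m → sum (List.tabulate {n = k} λ i → occurrences (toℕ i) j) ≡ finalTrues
  sum-occurrences {j} j<m = +-cancelʳ-≡ (total ws (prefix j)) _ _ (begin
    sum (List.tabulate {n = k} λ i → occurrences (toℕ i) j) + total ws (prefix j)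
      ≡⟨ cong (sum (List.tabulate {n = k} λ i → occurrences (toℕ i) j) +_) (sum-exceeding j) ⟨
    sum (List.tabulate {n = k} λ i → occurrences (toℕ i) j) + sum (List.tabulate {n = k} λ i → exceeding (toℕ i) j)
      ≡⟨ sum-tabulate-+ {k} (λ i → occurrences (toℕ i) j) _ ⟨
    sum (List.tabulate {n = k} λ i → occurrences (toℕ i) j + exceeding (toℕ i) j)
      ≡⟨ sum-tabulate-cong {k} (λ i → occurrences-exceeding (toℕ i) j<m) ⟩
    sum (List.tabulate {n = k} λ i → exceeding (toℕ i) (suc j))
      ≡⟨ sum-exceeding (suc j) ⟩
    total ws (prefix (suc j))
      ≡⟨ total-prefix-suc j<m ⟩
    finalTrues + total ws (prefix j) ∎)
    where open ≡-Reasoning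

occurrences-below : ∀ {k lo hi v} (xs : Vec ℕ k) → Chain lo xs hi → v ≤ lo →
  sum (List.tabulate λ i → 𝟙 (lookup xs i ≡ᵇ v)) ≡ 0
occurrences-below []       _           _    = refl
occurrences-below {v = v} (x ∷ xs) (lo<x , ch) v≤lo
  rewrite dec-false (x ≟ v) (λ { refl → <⇒≱ lo<x v≤lo }) =
  occurrences-below xs ch (≤-trans v≤lo (<⇒≤ lo<x))
-- In a strictly increasing tuple a value matches at most one column, so counting matches decides
-- membership.
𝟙-∈ : ∀ {k lo hi} v (xs : Vec ℕ k) → Chain lo xs hi →
  𝟙 (does (v ∈ᵛ? xs)) ≡ sum (List.tabulate λ i → 𝟙 (lookup xs i ≡ᵇ v))
𝟙-∈ v []       _        = refl
𝟙-∈ v (x ∷ xs) (_ , ch) with x ≟ v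
... | yes refl rewrite dec-true (x ≟ x) refl = cong suc (sym (occurrences-below xs ch ≤-refl))
... | no x≢v rewrite dec-false (x ≟ v) x≢v | dec-false (v ≟ x) (x≢v ∘ sym) = 𝟙-∈ v xs ch
𝟙-∈-S : ∀ {k m} (x : S k m) v →
  𝟙 (does (v ∈ᵛ? tuple x)) ≡ sum (List.tabulate λ i → 𝟙 (lookup (tuple x) i ≡ᵇ v))
𝟙-∈-S (mkS xs inc) v = recompute (_ ≟ _) (𝟙-∈ v xs (S-chain inc))

module OrbitCounts (ν : Permutation′ (suc k)) (O : Orbit (W {suc k} {suc m} ν)) where

  open Conjugacy (winching-conjugacy {k} {suc m} ν) using (periodic)

  subsetOf : S (suc k) (suc m) → KSubset (suc k) (suc m)
  subsetOf x = proj₁ (fromSubset-surjective ν x)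

  fromSubset-subsetOf : ∀ x → fromSubset ν (subsetOf x) ≡ x
  fromSubset-subsetOf x = proj₂ (fromSubset-surjective ν x)

  word : S (suc k) (suc m) → Vec Bool (suc m)
  word = set ∘ subsetOf

  word-W : ∀ x → word (W ν x) ≡ rotateVec (word x)
  word-W x = trans (cong set (fromSubset-injective ν {subsetOf (W ν x)} {rotateSubset (subsetOf x)} (begin
    fromSubset ν (subsetOf (W ν x))              ≡⟨ fromSubset-subsetOf (W ν x) ⟩
    W ν x                                        ≡⟨ cong (W ν) (fromSubset-subsetOf x) ⟨
    W ν (fromSubset ν (subsetOf x))              ≡⟨ fromSubset-rotate ν (subsetOf x) ⟨
    fromSubset ν (rotateSubset (subsetOf x))     ∎))) (image-next (word x))
    where open ≡-Reasoning

  lookup-word : ∀ x i → lookup (tuple x) i ≡ pos (suc (toℕ i)) (ρ (word x) (offset ν (toℕ i)))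
  lookup-word x i = trans (cong (λ y → lookup (tuple y) i) (sym (fromSubset-subsetOf x)))
    (readings-readsFrom ν (word x) i)

  -- `word` carries `W ν` to rotation, so invariance of the orbit under `W ν` passes to its words.
  rotated : map rotateVec (map word (elements O)) ↭ map word (elements O)
  rotated = ↭-trans
    (↭-reflexive (trans (sym (map-∘ (elements O)))
      (trans (map-cong (sym ∘ word-W) (elements O)) (map-∘ (elements O)))))
    (map⁺ word (orbit-map-↭ {N = suc m} (periodic {suc m} rotateSubset-periodic) O))

  open RotationInvariant (map word (elements O)) rotated
    (All.map⁺ (All.universal (recompute-card ∘ subsetOf) (elements O)))

  total-g : ∀ i j → total (elements O) (λ x → 𝟙 (lookup (tuple x) i ≡ᵇ suc j)) ≡ occurrences (toℕ i) j
  total-g i j = begin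
    total (elements O) (λ x → 𝟙 (lookup (tuple x) i ≡ᵇ suc j))
      ≡⟨ total-cong (elements O) (λ x → cong (λ p → 𝟙 (p ≡ᵇ suc j)) (lookup-word x i)) ⟩
    total (elements O) (λ x → 𝟙 (pos (suc (toℕ i)) (ρ (word x) (offset ν (toℕ i))) ≡ᵇ suc j))
      ≡⟨ cong sum (map-∘ (elements O)) ⟩
    total (map word (elements O)) (λ w → 𝟙 (pos (suc (toℕ i)) (ρ w (offset ν (toℕ i))) ≡ᵇ suc j))
      ≡⟨ total-ρ (λ w → 𝟙 (pos (suc (toℕ i)) w ≡ᵇ suc j)) (offset ν (toℕ i)) ⟩
    occurrences (toℕ i) j ∎
    where open ≡-Reasoning

  total-g-opposite : ∀ (i : Fin (suc k)) (j : Fin (suc m)) →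
    total (elements O) (λ x → 𝟙 (lookup (tuple x) i ≡ᵇ suc (toℕ j))) ≡
    total (elements O) (λ x → 𝟙 (lookup (tuple x) (opposite i) ≡ᵇ suc (toℕ (opposite j))))
  total-g-opposite i j = trans (total-g i (toℕ j)) (trans
    (occurrences-symmetric (toℕ i) (toℕ (opposite i)) (toℕ j) (toℕ (opposite j)) (opposite-sum i) (opposite-sum j))
    (sym (total-g (opposite i) (toℕ (opposite j)))))
    where
    opposite-sum : ∀ {n} (i : Fin n) → suc (toℕ i + toℕ (opposite i)) ≡ n
    opposite-sum i = trans (cong (suc (toℕ i) +_) (opposite-prop i)) (m+[n∸m]≡n (toℕ<n i))

  total-f : ∀ (j : Fin (suc m)) →
    suc m * total (elements O) (λ x → 𝟙 (does (suc (toℕ j) ∈ᵛ? tuple x))) ≡ length (elements O) * suc k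
  total-f j = begin
    suc m * total (elements O) (λ x → 𝟙 (does (suc (toℕ j) ∈ᵛ? tuple x)))
      ≡⟨ cong (suc m *_) (total-cong (elements O) (λ x → 𝟙-∈-S x (suc (toℕ j)))) ⟩
    suc m * total (elements O) (λ x → sum (List.tabulate λ i → 𝟙 (lookup (tuple x) i ≡ᵇ suc (toℕ j))))
      ≡⟨ cong (suc m *_) (total-tabulate (suc k) (λ i x → 𝟙 (lookup (tuple x) i ≡ᵇ suc (toℕ j))) (elements O)) ⟩
    suc m * sum (List.tabulate λ i → total (elements O) (λ x → 𝟙 (lookup (tuple x) i ≡ᵇ suc (toℕ j))))
      ≡⟨ cong (suc m *_) (sum-tabulate-cong (λ i → total-g i (toℕ j))) ⟩
    suc m * sum (List.tabulate {n = suc k} λ i → occurrences (toℕ i) (toℕ j))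
      ≡⟨ cong (suc m *_) (sum-occurrences (toℕ<n j)) ⟩
    suc m * finalTrues
      ≡⟨ m*finalTrues ⟩
    length (map word (elements O)) * suc k
      ≡⟨ cong (_* suc k) (length-map word (elements O)) ⟩
    length (elements O) * suc k ∎
    where open ≡-Reasoning

-- Averages

open import Data.Integer using (+_)

-- `n · 1ℚ` serves as the embedding of ℕ into ℚ, with homomorphism laws from the semiring structure;
-- this links it to fractions.
toℚᵘ-·1 : ∀ n → toℚᵘ (n · 1ℚ) ≃ᵘ mkℚᵘ (+ n) 0
toℚᵘ-·1 zero    = ℚᵘ.≃-refl
toℚᵘ-·1 (suc n) = begin
  toℚᵘ (1ℚ ℚ.+ n · 1ℚ)        ≈⟨ ℚ.toℚᵘ-homo-+ 1ℚ (n · 1ℚ) ⟩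
  ℚᵘ.1ℚᵘ ℚᵘ.+ toℚᵘ (n · 1ℚ)   ≈⟨ ℚᵘ.+-congʳ ℚᵘ.1ℚᵘ (toℚᵘ-·1 n) ⟩
  ℚᵘ.1ℚᵘ ℚᵘ.+ mkℚᵘ (+ n) 0    ≈⟨ *≡* (cong (ℤ._* + 1) (cong (λ z → + 1 ℤ.+ z) (ℤ.*-identityʳ (+ n)))) ⟩
  mkℚᵘ (+ suc n) 0            ∎
  where open ℚᵘ.≃-Reasoning

-- Checked on unnormalised rationals, where equality is cross-multiplication and no reduction to
-- lowest terms interferes.
/-*-denominator : ∀ k m .{{_ : NonZero m}} → (+ k / m) ℚ.* (m · 1ℚ) ≡ k · 1ℚ
/-*-denominator k (suc m) = ℚ.toℚᵘ-injective (begin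
  toℚᵘ (+ k / suc m ℚ.* (suc m · 1ℚ))         ≈⟨ ℚ.toℚᵘ-homo-* (+ k / suc m) (suc m · 1ℚ) ⟩
  toℚᵘ (+ k / suc m) ℚᵘ.* toℚᵘ (suc m · 1ℚ)   ≈⟨ ℚᵘ.*-cong (ℚ.toℚᵘ-fromℚᵘ (mkℚᵘ (+ k) m)) (toℚᵘ-·1 (suc m)) ⟩
  mkℚᵘ (+ k) m ℚᵘ.* mkℚᵘ (+ suc m) 0          ≈⟨ *≡* (trans (ℤ.*-identityʳ _) (cong (λ n → + k ℤ.* + n) (sym (*-identityʳ (suc m))))) ⟩
  mkℚᵘ (+ k) 0                                ≈⟨ toℚᵘ-·1 k ⟨
  toℚᵘ (k · 1ℚ)                               ∎)
  where open ℚᵘ.≃-Reasoning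

1/-*-cancel : ∀ m .{{_ : NonZero m}} q → (+ 1 / m) ℚ.* ((m · 1ℚ) ℚ.* q) ≡ q
1/-*-cancel m q = begin
  (+ 1 / m) ℚ.* ((m · 1ℚ) ℚ.* q)   ≡⟨ ℚ.*-assoc (+ 1 / m) (m · 1ℚ) q ⟨
  (+ 1 / m) ℚ.* (m · 1ℚ) ℚ.* q     ≡⟨ cong (ℚ._* q) (/-*-denominator 1 m) ⟩
  1ℚ ℚ.* q                         ≡⟨ ℚ.*-identityˡ q ⟩
  q                                ∎
  where open ≡-Reasoning

-- Termwise means of real-valued functions

∑ℚ : List X → (X → ℚ) → ℚ
∑ℚ xs φ = foldr (λ x s → φ x ℚ.+ s) 0ℚ xs

seq-∑ : ∀ xs (φ : X → ℝ) n → seq (∑ xs φ) n ≡ ∑ℚ xs (λ x → seq (φ x) n)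
seq-∑ []       φ n = refl
seq-∑ (x ∷ xs) φ n = cong (λ q → seq (φ x) n ℚ.+ q) (seq-∑ xs φ n)

∑ℚ-cong : ∀ {φ ψ : X → ℚ} xs → (∀ x → φ x ≡ ψ x) → ∑ℚ xs φ ≡ ∑ℚ xs ψ
∑ℚ-cong []       eq = refl
∑ℚ-cong (x ∷ xs) eq = cong₂ ℚ._+_ (eq x) (∑ℚ-cong xs eq)

∑ℚ-+ : ∀ (φ ψ : X → ℚ) xs → ∑ℚ xs (λ x → φ x ℚ.+ ψ x) ≡ ∑ℚ xs φ ℚ.+ ∑ℚ xs ψ
∑ℚ-+ φ ψ []       = refl
∑ℚ-+ φ ψ (x ∷ xs) = trans (cong (λ q → φ x ℚ.+ ψ x ℚ.+ q) (∑ℚ-+ φ ψ xs)) (ℚ-interchange (φ x) (ψ x) _ _)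

∑ℚ-* : ∀ c (φ : X → ℚ) xs → ∑ℚ xs (λ x → c ℚ.* φ x) ≡ c ℚ.* ∑ℚ xs φ
∑ℚ-* c φ []       = sym (ℚ.*-zeroʳ c)
∑ℚ-* c φ (x ∷ xs) = trans (cong (λ q → c ℚ.* φ x ℚ.+ q) (∑ℚ-* c φ xs)) (sym (ℚ.*-distribˡ-+ c (φ x) _))

∑ℚ-neg : ∀ (φ : X → ℚ) xs → ∑ℚ xs (λ x → ℚ.- φ x) ≡ ℚ.- ∑ℚ xs φ
∑ℚ-neg φ []       = refl
∑ℚ-neg φ (x ∷ xs) = trans (cong (λ q → ℚ.- φ x ℚ.+ q) (∑ℚ-neg φ xs)) (sym (ℚ.neg-distrib-+ (φ x) _))

∑ℚ-total : ∀ (φ : X → ℕ) xs → ∑ℚ xs (λ x → φ x · 1ℚ) ≡ total xs φ · 1ℚ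
∑ℚ-total φ []       = refl
∑ℚ-total φ (x ∷ xs) = trans (cong (λ q → φ x · 1ℚ ℚ.+ q) (∑ℚ-total φ xs)) (sym (×-homo-+ 1ℚ (φ x) _))

-- The mean is required term by term of the Cauchy sequences; this is stronger than _≃_, and linear.
record HasMean (xs : List X) (c : ℝ) (φ : X → ℝ) : Set where
  field
    termwise : ∀ n → ∑ℚ xs (λ x → seq (φ x) n) ≡ (length xs · 1ℚ) ℚ.* seq c n

open HasMean

-- The linear form behind `linearCombination`, abstracted so that it can be evaluated both at the
-- functions and at their means.
combination : (Fin k → Fin m → ℝ) → (Fin m → ℝ) → (Fin k → Fin m → ℝ) → (Fin m → ℝ) → ℝ
combination {k} {m} a b u v =
  ∑ (allFin k) (λ i → ∑ (allFin m) λ j → a i j *ᴿ u i j) +ᴿ ∑ (allFin m) (λ j → b j *ᴿ v j)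

module _ {xs : List X} where

  hasMean-0 : HasMean xs 0ℝ (λ _ → 0ℝ)
  hasMean-0 .termwise n = trans (zeros xs) (sym (ℚ.*-zeroʳ (length xs · 1ℚ)))
    where
    zeros : ∀ (ys : List X) → ∑ℚ ys (λ _ → 0ℚ) ≡ 0ℚ
    zeros []       = refl
    zeros (_ ∷ ys) = trans (ℚ.+-identityˡ _) (zeros ys)

  hasMean-+ : ∀ {b c φ ψ} → HasMean xs b φ → HasMean xs c ψ →
    HasMean xs (b +ᴿ c) (λ x → φ x +ᴿ ψ x)
  hasMean-+ {b} {c} {φ} {ψ} p q .termwise n = begin
    ∑ℚ xs (λ x → seq (φ x) n ℚ.+ seq (ψ x) n)
      ≡⟨ ∑ℚ-+ (λ x → seq (φ x) n) (λ x → seq (ψ x) n) xs ⟩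
    ∑ℚ xs (λ x → seq (φ x) n) ℚ.+ ∑ℚ xs (λ x → seq (ψ x) n)
      ≡⟨ cong₂ ℚ._+_ (p .termwise n) (q .termwise n) ⟩
    (length xs · 1ℚ) ℚ.* seq b n ℚ.+ (length xs · 1ℚ) ℚ.* seq c n
      ≡⟨ ℚ.*-distribˡ-+ (length xs · 1ℚ) (seq b n) (seq c n) ⟨
    (length xs · 1ℚ) ℚ.* (seq b n ℚ.+ seq c n) ∎
    where open ≡-Reasoning

  hasMean-* : ∀ a {c φ} → HasMean xs c φ → HasMean xs (a *ᴿ c) (λ x → a *ᴿ φ x)
  hasMean-* a {c} {φ} p .termwise n = begin
    ∑ℚ xs (λ x → seq a n ℚ.* seq (φ x) n)        ≡⟨ ∑ℚ-* (seq a n) (λ x → seq (φ x) n) xs ⟩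
    seq a n ℚ.* ∑ℚ xs (λ x → seq (φ x) n)        ≡⟨ cong (seq a n ℚ.*_) (p .termwise n) ⟩
    seq a n ℚ.* ((length xs · 1ℚ) ℚ.* seq c n)   ≡⟨ x∙yz≈y∙xz (seq a n) (length xs · 1ℚ) (seq c n) ⟩
    (length xs · 1ℚ) ℚ.* (seq a n ℚ.* seq c n)   ∎
    where open ≡-Reasoning

  hasMean-∑ : (ys : List Y) {c : Y → ℝ} {φ : Y → X → ℝ} → (∀ y → HasMean xs (c y) (φ y)) →
    HasMean xs (∑ ys c) (λ x → ∑ ys (λ y → φ y x))
  hasMean-∑ []       mean = hasMean-0
  hasMean-∑ (y ∷ ys) {c} {φ} mean =
    hasMean-+ {c y} {∑ ys c} {φ y} {λ x → ∑ ys λ z → φ z x} (mean y) (hasMean-∑ ys mean)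

  hasMean-combination : ∀ a b {u : Fin k → Fin m → ℝ} {v : Fin m → ℝ}
    {δ : Fin k → Fin m → X → ℝ} {η : Fin m → X → ℝ} →
    (∀ i j → HasMean xs (u i j) (δ i j)) → (∀ j → HasMean xs (v j) (η j)) →
    HasMean xs (combination a b u v) (λ x → combination a b (λ i j → δ i j x) (λ j → η j x))
  hasMean-combination {k} {m} a b {u} {v} {δ} {η} p q = hasMean-+
    {∑ (allFin k) λ i → ∑ (allFin m) λ j → a i j *ᴿ u i j}
    {∑ (allFin m) λ j → b j *ᴿ v j}
    {λ x → ∑ (allFin k) λ i → ∑ (allFin m) λ j → a i j *ᴿ δ i j x}
    {λ x → ∑ (allFin m) λ j → b j *ᴿ η j x}
    (hasMean-∑ (allFin k) {λ i → ∑ (allFin m) λ j → a i j *ᴿ u i j}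
      {λ i x → ∑ (allFin m) λ j → a i j *ᴿ δ i j x} λ i →
        hasMean-∑ (allFin m) {λ j → a i j *ᴿ u i j} {λ j x → a i j *ᴿ δ i j x} λ j →
          hasMean-* (a i j) {u i j} {δ i j} (p i j))
    (hasMean-∑ (allFin m) {λ j → b j *ᴿ v j} {λ j x → b j *ᴿ η j x} λ j →
      hasMean-* (b j) {v j} {η j} (q j))

  -- A factor `m` is inserted and cancelled again, so that the identity between natural numbers can
  -- be applied in between.
  ∑ℚ-proportional : ∀ k m .{{_ : NonZero m}} (φ : X → ℕ) → m * total xs φ ≡ length xs * k →
    ∑ℚ xs (λ x → φ x · 1ℚ) ≡ (length xs · 1ℚ) ℚ.* (+ k / m)
  ∑ℚ-proportional k m φ eq = begin
    ∑ℚ xs (λ x → φ x · 1ℚ)                           ≡⟨ ∑ℚ-total φ xs ⟩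
    T                                                ≡⟨ 1/-*-cancel m T ⟨
    (+ 1 / m) ℚ.* ((m · 1ℚ) ℚ.* T)                   ≡⟨ cong ((+ 1 / m) ℚ.*_) (×1-homo-* m (total xs φ)) ⟨
    (+ 1 / m) ℚ.* ((m * total xs φ) · 1ℚ)            ≡⟨ cong (λ n → (+ 1 / m) ℚ.* (n · 1ℚ)) eq ⟩
    (+ 1 / m) ℚ.* ((length xs * k) · 1ℚ)             ≡⟨ cong ((+ 1 / m) ℚ.*_) (×1-homo-* (length xs) k) ⟩
    (+ 1 / m) ℚ.* (L ℚ.* (k · 1ℚ))                   ≡⟨ cong (λ q → (+ 1 / m) ℚ.* (L ℚ.* q)) (/-*-denominator k m) ⟨
    (+ 1 / m) ℚ.* (L ℚ.* ((+ k / m) ℚ.* (m · 1ℚ)))   ≡⟨ cong ((+ 1 / m) ℚ.*_) (x∙yz≈z∙xy L (+ k / m) (m · 1ℚ)) ⟩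
    (+ 1 / m) ℚ.* ((m · 1ℚ) ℚ.* (L ℚ.* (+ k / m)))   ≡⟨ 1/-*-cancel m (L ℚ.* (+ k / m)) ⟩
    L ℚ.* (+ k / m)                                  ∎
    where
    open ≡-Reasoning
    T = total xs φ · 1ℚ
    L = length xs · 1ℚ

  ∑ℚ-difference : ∀ (φ ψ : X → ℕ) → total xs φ ≡ total xs ψ →
    ∑ℚ xs (λ x → φ x · 1ℚ ℚ.- ψ x · 1ℚ) ≡ (length xs · 1ℚ) ℚ.* 0ℚ
  ∑ℚ-difference φ ψ eq = begin
    ∑ℚ xs (λ x → φ x · 1ℚ ℚ.- ψ x · 1ℚ)
      ≡⟨ ∑ℚ-+ (λ x → φ x · 1ℚ) (λ x → ℚ.- (ψ x · 1ℚ)) xs ⟩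
    ∑ℚ xs (λ x → φ x · 1ℚ) ℚ.+ ∑ℚ xs (λ x → ℚ.- (ψ x · 1ℚ))
      ≡⟨ cong₂ ℚ._+_ (trans (∑ℚ-total φ xs) (cong (_· 1ℚ) eq))
                   (trans (∑ℚ-neg (λ x → ψ x · 1ℚ) xs) (cong ℚ.-_ (∑ℚ-total ψ xs))) ⟩
    total xs ψ · 1ℚ ℚ.- total xs ψ · 1ℚ
      ≡⟨ ℚ.+-inverseʳ (total xs ψ · 1ℚ) ⟩
    0ℚ
      ≡⟨ ℚ.*-zeroʳ (length xs · 1ℚ) ⟨
    (length xs · 1ℚ) ℚ.* 0ℚ ∎
    where open ≡-Reasoning

  average-≃ : ∀ {φ c} .{{_ : NonZero (length xs)}} → HasMean xs c φ → average φ xs ≃ c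
  -- The difference vanishes in every term, so the threshold 0 works for each `ε`.
  average-≃ {φ} {c} mean ε 0<ε = 0 , λ n _ → subst (ℚ._< ε) (sym (cong ℚ.∣_∣ (begin
    (+ 1 / length xs) ℚ.* seq (∑ xs φ) n ℚ.- seq c n
      ≡⟨ cong (λ q → (+ 1 / length xs) ℚ.* q ℚ.- seq c n) (trans (seq-∑ xs φ n) (mean .termwise n)) ⟩
    (+ 1 / length xs) ℚ.* ((length xs · 1ℚ) ℚ.* seq c n) ℚ.- seq c n
      ≡⟨ cong (ℚ._- seq c n) (1/-*-cancel (length xs) (seq c n)) ⟩
    seq c n ℚ.- seq c n
      ≡⟨ ℚ.+-inverseʳ (seq c n) ⟩
    0ℚ ∎))) 0<ε
    where open ≡-Reasoning

seq-[]? : {P : Set} (P? : Dec P) → ∀ n → seq [ P? ]? n ≡ 𝟙 (does P?) · 1ℚ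
seq-[]? P? n with does P?
... | true  = refl
... | false = refl

module _ {k m : ℕ} (ν : Permutation′ (suc k)) (O : Orbit (W {suc k} {suc m} ν)) where

  open OrbitCounts ν O

  hasMean-d : ∀ i j → HasMean (elements O) 0ℝ (d i j)
  hasMean-d i j .termwise n = trans
    (∑ℚ-cong (elements O) λ x → cong₂ ℚ._-_
      (seq-[]? (lookup (tuple x) i ≟ suc (toℕ j)) n)
      (seq-[]? (lookup (tuple x) (opposite i) ≟ suc (toℕ (opposite j))) n))
    (∑ℚ-difference {xs = elements O}
      (λ x → 𝟙 (lookup (tuple x) i ≡ᵇ suc (toℕ j)))
      (λ x → 𝟙 (lookup (tuple x) (opposite i) ≡ᵇ suc (toℕ (opposite j))))
      (total-g-opposite i j))

  hasMean-f : ∀ j → HasMean (elements O) (fromℚ (+ suc k / suc m)) (f j)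
  hasMean-f j .termwise n = trans
    (∑ℚ-cong (elements O) λ x → seq-[]? (suc (toℕ j) ∈ᵛ? tuple x) n)
    (∑ℚ-proportional {xs = elements O} (suc k) (suc m)
      (λ x → 𝟙 (does (suc (toℕ j) ∈ᵛ? tuple x))) (total-f j))

  hasMean-linearCombination : ∀ a b → HasMean (elements O)
    (combination a b (λ _ _ → 0ℝ) (λ _ → fromℚ (+ suc k / suc m))) (linearCombination a b)
  hasMean-linearCombination a b =
    hasMean-combination a b {λ _ _ → 0ℝ} {λ _ → fromℚ (+ suc k / suc m)} {d} {f} hasMean-d hasMean-f

mainTheorem5 : ∀ (k m : ℕ) (1≤k : 1 ≤ k) (k≤m : k ≤ m) (ν : Permutation′ k) →
    (∀ (x : S k m) → iterate (W ν) x m ≡ x)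
    × (SameOrbitStructure (W {k} {m} ν) (rotateSubset {k} {m})
    × SameOrbitStructure (W {k} {m} ν) (rotateNecklace {k} {m})
    × (∀ (ν′ : Permutation′ k) → SameOrbitStructure (W {k} {m} ν) (W {k} {m} ν′)))
    × ((∀ (i : Fin k) (j : Fin m) → (0ℝ -mesicFor W {k} {m} ν) (d i j))
    × (∀ (j : Fin m) → (fromℚ (_/_ (+ k) m {{>-nonZero (≤-trans 1≤k k≤m)}}) -mesicFor W {k} {m} ν) (f j))
    × (∀ (a : Fin k → Fin m → ℝ) (b : Fin m → ℝ) → HomomesicFor (W {k} {m} ν) (linearCombination a b)))
-- The bounds `1 ≤ k ≤ m` rule out zero for both numbers.
mainTheorem5 (suc k) (suc m) _ _ ν =
  Conjugacy.periodic (winching-conjugacy ν) {suc m} rotateSubset-periodic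
  , ( conjugate⇒sameOrbitStructure (winching-conjugacy ν) rotations
    , conjugates⇒sameOrbitStructure (winching-conjugacy ν) necklace-conjugacy rotations
    , λ ν′ → conjugates⇒sameOrbitStructure (winching-conjugacy ν) (winching-conjugacy ν′) rotations)
  , ( (λ i j O → average-≃ {{size-nonZero O}} (hasMean-d ν O i j))
    , (λ j O → average-≃ {{size-nonZero O}} (hasMean-f ν O j))
    , λ a b → combination a b (λ _ _ → 0ℝ) (λ _ → fromℚ (+ suc k / suc m)) ,
        λ O → average-≃ {{size-nonZero O}} (hasMean-linearCombination ν O a b))
  where
  rotations : OrbitPartition (rotateSubset {suc k} {suc m})
  rotations = orbitPartition {N = suc m} rotateSubset-periodic
    (λ A B → map′ KSubset-ext (cong set) (Vec.≡-dec Bool._≟_ (set A) (set B)))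
    (allSubsets (suc k) (suc m)) ∈-allSubsets
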